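{- Let $a$ be a positive integer and $k\ge0$ an integer, and define $$CM_{a^k} = \sum_\lambda (-1)^{|\lambda|} \binom{n_a(\lambda) + k}{k}\, m_{\lambda + (a^k)}\, e_\lambda^\perp ,$$ the sum over all partitions $\lambda$. Then $CM_{a^k} m_\lambda = m_{\lambda + a^k}$ for every partition $\lambda$, with the convention that $m_{\lambda + a^k} = 0$ if $l(\lambda)>k$.
   Context: $m_\lambda$, $e_\lambda$ are the monomial and elementary symmetric functions; $g^\perp$ is the adjoint of multiplication by $g$ with respect to the Hall inner product. $n_a(\lambda)$ is the number of parts of $\lambda$ equal to $a$. $\lambda+(a^k)$ denotes the partition obtained from $\lambda$ by inserting $k$ parts equal to $a$, while $\lambda+a^k$ (for $l(\lambda)\le k$) denotes $(\lambda_1+a,\ldots,\lambda_k+a)$ with $\lambda_i=0$ for $i>l(\lambda)$, i.e. $\lambda$ with $a$ columns of height $k$ added. -}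

module Defs where

open import Data.Bool using (Bool; true; false; _∧_; not; if_then_else_; T)
open import Data.Nat as ℕ using (ℕ; zero; suc; _∸_; _≤ᵇ_; _≡ᵇ_)
open import Data.Nat.Combinatorics using (_C_)
open import Data.Integer as ℤ using (ℤ; +_)
open import Data.List using (List; []; _∷_; _++_; map; concatMap; foldr; length; filter; replicate; zipWith; upTo; applyUpTo)
import Data.List.Properties as LP
open import Data.Nat.ListAction using (sum)
open import Data.Maybe using (Maybe; just; nothing; maybe)
open import Data.Product using (Σ; _×_; _,_; proj₁; proj₂)
open import Relation.Nullary.Decidable using (T?; yes; no; ⌊_⌋; does)
open import Relation.Binary.PropositionalEquality using (_≡_)

isDecr : List ℕ → Bool
isDecr []           = true
isDecr (x ∷ [])     = true
isDecr (x ∷ y ∷ ys) = (y ≤ᵇ x) ∧ isDecr (y ∷ ys)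

allPos : List ℕ → Bool
allPos []       = true
allPos (x ∷ xs) = (1 ≤ᵇ x) ∧ allPos xs

isPart : List ℕ → Bool
isPart l = allPos l ∧ isDecr l

Partition : Set
Partition = Σ (List ℕ) (λ l → T (isPart l))

toPart : List ℕ → Maybe Partition
toPart l with T? (isPart l)
... | yes p = just (l , p)
... | no _  = nothing

_==L_ : List ℕ → List ℕ → Bool
xs ==L ys = does (LP.≡-dec ℕ._≟_ xs ys)

size : Partition → ℕ
size λp = sum (proj₁ λp)

count : ℕ → List ℕ → ℕ
count a []       = 0
count a (x ∷ xs) = if a ≡ᵇ x then suc (count a xs) else count a xs

nPart : ℕ → Partition → ℕ
nPart a λp = count a (proj₁ λp)

insertD : ℕ → List ℕ → List ℕ
insertD x []       = x ∷ []
insertD x (y ∷ ys) = if y ≤ᵇ x then x ∷ y ∷ ys else y ∷ insertD x ys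

sortD : List ℕ → List ℕ
sortD = foldr insertD []

shape : List ℕ → List ℕ
shape α = sortD (filter (λ x → T? (1 ≤ᵇ x)) α)

pbF : ℕ → ℕ → ℕ → List (List ℕ)
pbF zero    zero    m = [] ∷ []
pbF zero    (suc n) m = []
pbF (suc f) zero    m = [] ∷ []
pbF (suc f) (suc n) m =
  concatMap (λ p → map (p ∷_) (pbF f (suc n ∸ p) p)) (applyUpTo suc (ℕ._⊓_ m (suc n)))

mapMaybe' : {A B : Set} → (A → Maybe B) → List A → List B
mapMaybe' f []       = []
mapMaybe' f (x ∷ xs) = maybe (λ b → b ∷ mapMaybe' f xs) (mapMaybe' f xs) (f x)

partitionsOf : ℕ → List Partition
partitionsOf n = mapMaybe' toPart (pbF n n n)

partitionsUpTo : ℕ → List Partition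
partitionsUpTo N = concatMap partitionsOf (upTo (suc N))

-- The ring Λ of symmetric functions over ℤ, represented by finite formal
-- ℤ-linear combinations of monomial symmetric functions m_λ.

Λ : Set
Λ = List (ℤ × Partition)

coeff : Λ → Partition → ℤ
coeff []             ν = + 0
coeff ((c , λp) ∷ f) ν =
  if proj₁ λp ==L proj₁ ν then c ℤ.+ coeff f ν else coeff f ν

_≈_ : Λ → Λ → Set
f ≈ g = (ν : Partition) → coeff f ν ≡ coeff g ν

zeroΛ : Λ
zeroΛ = []

m : Partition → Λ
m λp = (+ 1 , λp) ∷ []

-- m_l for a list l which is a partition (zero otherwise; only used on partitions)
mL : List ℕ → Λ
mL l = maybe m zeroΛ (toPart l)

_•_ : ℤ → Λ → Λ
c • f = map (λ t → (c ℤ.* proj₁ t , proj₂ t)) f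

_⊕_ : Λ → Λ → Λ
_⊕_ = _++_

boxes : List ℕ → List (List ℕ)
boxes []       = [] ∷ []
boxes (n ∷ ns) = concatMap (λ i → map (i ∷_) (boxes ns)) (upTo (suc n))

-- coefficient of x^ν (ν a partition, in l(ν) variables) in m_λ m_μ:
-- number of α + β = ν with α a rearrangement of λ, β a rearrangement of μ
coeffProd : Partition → Partition → Partition → ℕ
coeffProd λp μp νp =
  length (filter (λ α → T? ((shape α ==L proj₁ λp) ∧ (shape (zipWith _∸_ (proj₁ νp) α) ==L proj₁ μp)))
                 (boxes (proj₁ νp)))

mulBasis : Partition → Partition → Λ
mulBasis λp μp = map (λ ν → (+ coeffProd λp μp ν , ν)) (partitionsOf (size λp ℕ.+ size μp))

infixl 7 _⊗_
_⊗_ : Λ → Λ → Λ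
f ⊗ g = concatMap (λ s → concatMap (λ t → (proj₁ s ℤ.* proj₁ t) • mulBasis (proj₂ s) (proj₂ t)) g) f

oneΛ : Λ
oneΛ = mL []

prodΛ : List Λ → Λ
prodΛ = foldr _⊗_ oneΛ

eE : ℕ → Λ
eE r = mL (replicate r 1)

hH : ℕ → Λ
hH r = concatMap m (partitionsOf r)

eP : Partition → Λ
eP λp = prodΛ (map eE (proj₁ λp))

hP : Partition → Λ
hP λp = prodΛ (map hH (proj₁ λp))

bilinExt : (Partition → Partition → ℤ) → Λ → Λ → ℤ
bilinExt B f g =
  foldr ℤ._+_ (+ 0) (map (λ s → foldr ℤ._+_ (+ 0)
     (map (λ t → proj₁ s ℤ.* proj₁ t ℤ.* B (proj₂ s) (proj₂ t)) g)) f)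

δ : Partition → Partition → ℤ
δ λp μp = if proj₁ λp ==L proj₁ μp then + 1 else + 0

record IsHallProduct (pair : Λ → Λ → ℤ) : Set where
  field
    bilinear : (f g : Λ) → pair f g ≡ bilinExt (λ λp μp → pair (m λp) (m μp)) f g
    dual     : (λp μp : Partition) → pair (hP λp) (m μp) ≡ δ λp μp

IsEPerp : (Λ → Λ → ℤ) → (Partition → Λ → Λ) → Set
IsEPerp pair skew = (λp : Partition) (f g : Λ) → pair (skew λp f) g ≡ pair f (eP λp ⊗ g)

insParts : ℕ → ℕ → Partition → List ℕ
insParts a k λp = sortD (replicate k a ++ proj₁ λp)

-- λ + a^k (for l(λ) ≤ k): add a to each of λ_1, …, λ_k (λ_i = 0 for i > l(λ))
addCols : ℕ → ℕ → Partition → List ℕ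
addCols a k λp = map (ℕ._+ a) (go k (proj₁ λp))
  where
  go : ℕ → List ℕ → List ℕ
  go zero    _        = []
  go (suc j) []       = 0 ∷ go j []
  go (suc j) (x ∷ xs) = x ∷ go j xs

signZ : ℕ → ℤ
signZ n = (ℤ.- (+ 1)) ℤ.^ n

CMpartial : ℕ → ℕ → (Partition → Λ → Λ) → ℕ → Λ → Λ
CMpartial a k skew N f =
  concatMap (λ λp → (signZ (size λp) ℤ.* (+ ((nPart a λp ℕ.+ k) C k)))
                      • (mL (insParts a k λp) ⊗ skew λp f))
            (partitionsUpTo N)

target : ℕ → ℕ → Partition → Λ
target a k λp = if length (proj₁ λp) ≤ᵇ k then mL (addCols a k λp) else zeroΛ

{-# OPTIONS --safe #-}
module Submission where

-- The coefficient of x^ν in m_{λ+(a^k)} g, for ν with n = l(ν) variables, splits as a sum over exponent vectors β + γ = ν.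
-- The factor C(n_a(λ)+k, k) turns this into a sum over k-subsets I of the variables with β = a on I, the exponents
-- β outside I forming λ. As the coefficient of m_γ in e_λ^⊥ m_μ is ⟨e_λ h_γ, m_μ⟩, summing over the splittings of ν_i
-- at one i outside I produces Σ_{b+c=ν_i} (-1)^b e_b h_c = 0, because ν_i > 0. So only I = {1,…,n} with n = k remains,
-- and it contributes ⟨h_{ν-a^k}, m_μ⟩, the coefficient of m_ν in m_{μ+a^k}.

open import Defs
open import Data.Nat as ℕ using (ℕ; zero; suc; _∸_; _≤_; _<_; z≤n; s≤s; _≤ᵇ_; _<ᵇ_; _≡ᵇ_)
import Data.Nat.Properties as ℕ
open import Data.Nat.Combinatorics using (_C_; nCn≡1; nCk≡nC[n∸k]; k>n⇒nCk≡0; nCk+nC[k+1]≡[n+1]C[k+1])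
open import Data.Nat.ListAction using (sum)
open import Data.Integer as ℤ using (ℤ; +_; -_; _+_; _*_)
open import Data.Integer.Properties as ℤ using (+-identityˡ; +-identityʳ; *-zeroˡ; *-zeroʳ; *-identityˡ; *-identityʳ; +-assoc; *-assoc; *-comm; *-distribˡ-+; *-distribʳ-+)
open import Data.Integer.Tactic.RingSolver using (solve-∀)
open import Data.Bool using (Bool; true; false; _∧_; if_then_else_; T)
open import Data.Bool.Properties using (T-irrelevant; T-∧; ∧-zeroʳ)
open import Data.Empty using (⊥-elim)
open import Data.Unit using (tt)
open import Data.List using (List; []; _∷_; _++_; map; concatMap; foldr; length; filter; replicate; zipWith; upTo; applyUpTo)
import Data.List.Properties as List
open import Data.List.Relation.Unary.All using (All; []; _∷_)
import Data.List.Relation.Unary.All as All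
import Data.List.Relation.Unary.All.Properties as All
open import Data.Product using (_×_; _,_; proj₁; proj₂; ∃-syntax)
open import Data.Sum using (inj₁; inj₂)
open import Function using (_∘_; _∋_; Equivalence)
open import Relation.Nullary using (¬_; yes; no)
open import Relation.Nullary.Decidable using (T?)
open import Relation.Binary.PropositionalEquality

-- The Hall product is known only through bilinearity and ⟨h_λ, m_μ⟩ = δ, in this order. The
-- adjunction puts e_λ h_γ in the second argument, so symmetry of the form has to be derived; and
-- for the sum over λ to become finite the form has to respect degree. Both are linear algebra in
-- the monomial basis. The matrix expressing the h_λ in the m_μ is graded, and it is symmetric
-- because its entries count ℕ-matrices with prescribed row and column sums. The duality axiom says
-- that this matrix times the Gram matrix is the identity, which passes both properties on to the
-- Gram matrix.
--
-- The argument treats one variable at a time. Splitting a partition or stripping its first entry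
-- leaves lists that are unsorted or contain zeros, whereas `coeff` is defined at partitions only.
-- Coefficients are therefore read at arbitrary exponent vectors, as functions invariant under
-- reordering and insertion of zeros, and products become convolutions. Since zeros may be inserted
-- freely, only positive parts have a well-defined multiplicity; this is where a ≥ 1 enters.

private variable
  A B : Set

-- Finite sums of integers

∑ : List A → (A → ℤ) → ℤ
∑ []       f = + 0
∑ (x ∷ xs) f = f x + ∑ xs f

∑-cong-All : ∀ {f g : A → ℤ} {xs} → All (λ x → f x ≡ g x) xs → ∑ xs f ≡ ∑ xs g
∑-cong-All []       = refl
∑-cong-All (p ∷ ps) = cong₂ _+_ p (∑-cong-All ps)

∑-cong : ∀ {f g : A → ℤ} xs → (∀ x → f x ≡ g x) → ∑ xs f ≡ ∑ xs g
∑-cong xs p = ∑-cong-All (All.universal p xs)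

∑-zero : ∀ (xs : List A) → ∑ xs (λ _ → + 0) ≡ + 0
∑-zero []       = refl
∑-zero (x ∷ xs) = trans (+-identityˡ _) (∑-zero xs)

∑-vanish : ∀ {f : A → ℤ} xs → (∀ x → f x ≡ + 0) → ∑ xs f ≡ + 0
∑-vanish xs p = trans (∑-cong xs p) (∑-zero xs)

∑-++ : ∀ xs ys (f : A → ℤ) → ∑ (xs ++ ys) f ≡ ∑ xs f + ∑ ys f
∑-++ []       ys f = sym (+-identityˡ _)
∑-++ (x ∷ xs) ys f = trans (cong (_+_ (f x)) (∑-++ xs ys f)) (sym (+-assoc (f x) (∑ xs f) (∑ ys f)))

∑-map : ∀ (h : A → B) xs (f : B → ℤ) → ∑ (map h xs) f ≡ ∑ xs (f ∘ h)
∑-map h []       f = refl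
∑-map h (x ∷ xs) f = cong (_+_ (f (h x))) (∑-map h xs f)

∑-concatMap : ∀ (h : A → List B) xs (f : B → ℤ) → ∑ (concatMap h xs) f ≡ ∑ xs (λ x → ∑ (h x) f)
∑-concatMap h []       f = refl
∑-concatMap h (x ∷ xs) f = trans (∑-++ (h x) (concatMap h xs) f) (cong (_+_ (∑ (h x) f)) (∑-concatMap h xs f))

+-interchange : ∀ a b c d → (a + b) + (c + d) ≡ (a + c) + (b + d)
+-interchange = solve-∀

*-swapʳ : ∀ x y z → x * y * z ≡ x * z * y
*-swapʳ = solve-∀

∑-+ : ∀ xs (f g : A → ℤ) → ∑ xs (λ x → f x + g x) ≡ ∑ xs f + ∑ xs g
∑-+ []       f g = refl
∑-+ (x ∷ xs) f g = trans (cong (_+_ (f x + g x)) (∑-+ xs f g)) (+-interchange (f x) (g x) _ _)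

∑-*ˡ : ∀ c xs (f : A → ℤ) → ∑ xs (λ x → c * f x) ≡ c * ∑ xs f
∑-*ˡ c []       f = sym (*-zeroʳ c)
∑-*ˡ c (x ∷ xs) f = trans (cong (_+_ (c * f x)) (∑-*ˡ c xs f)) (sym (*-distribˡ-+ c (f x) _))

∑-*ʳ : ∀ c xs (f : A → ℤ) → ∑ xs (λ x → f x * c) ≡ ∑ xs f * c
∑-*ʳ c xs f = trans (∑-cong xs λ x → *-comm (f x) c) (trans (∑-*ˡ c xs f) (*-comm c _))

∑-swap : ∀ (xs : List A) (ys : List B) (f : A → B → ℤ) →
  ∑ xs (λ x → ∑ ys (f x)) ≡ ∑ ys (λ y → ∑ xs (λ x → f x y))
∑-swap []       ys f = sym (∑-zero ys)
∑-swap (x ∷ xs) ys f = trans (cong (_+_ (∑ ys (f x))) (∑-swap xs ys f)) (sym (∑-+ ys (f x) _))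

∑-*-∑ : ∀ (xs : List A) (ys : List B) (f : A → ℤ) (g : B → ℤ) →
  ∑ xs f * ∑ ys g ≡ ∑ xs (λ x → ∑ ys (λ y → f x * g y))
∑-*-∑ xs ys f g = sym (trans (∑-cong xs λ x → ∑-*ˡ (f x) ys g) (∑-*ʳ (∑ ys g) xs f))

-- Truth values as the integers 0 and 1

⟦_⟧ : Bool → ℤ
⟦ true  ⟧ = + 1
⟦ false ⟧ = + 0

⟦⟧-∧ : ∀ a b → ⟦ a ∧ b ⟧ ≡ ⟦ a ⟧ * ⟦ b ⟧
⟦⟧-∧ true  b = sym (*-identityˡ _)
⟦⟧-∧ false b = sym (*-zeroˡ ⟦ b ⟧)

⟦⟧-true : ∀ {b} → T b → ⟦ b ⟧ ≡ + 1
⟦⟧-true {true} _ = refl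

⟦⟧-false : ∀ {b} → ¬ T b → ⟦ b ⟧ ≡ + 0
⟦⟧-false {true}  ¬p = ⊥-elim (¬p tt)
⟦⟧-false {false} _  = refl

⟦⟧-⇔ : ∀ {a b} → (T a → T b) → (T b → T a) → ⟦ a ⟧ ≡ ⟦ b ⟧
⟦⟧-⇔ {true}  {true}  f g = refl
⟦⟧-⇔ {true}  {false} f g = ⊥-elim (f tt)
⟦⟧-⇔ {false} {true}  f g = ⊥-elim (g tt)
⟦⟧-⇔ {false} {false} f g = refl

T-∧⁻ : ∀ {a b} → T (a ∧ b) → T a × T b
T-∧⁻ = Equivalence.to T-∧

T-∧⁺ : ∀ {a b} → T a → T b → T (a ∧ b)
T-∧⁺ p q = Equivalence.from T-∧ (p , q)

==L⇒≡ : ∀ xs ys → T (xs ==L ys) → xs ≡ ys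
==L⇒≡ []       []       _ = refl
==L⇒≡ (x ∷ xs) (y ∷ ys) p with T-∧⁻ {x ≡ᵇ y} p
... | q , r = cong₂ _∷_ (ℕ.≡ᵇ⇒≡ x y q) (==L⇒≡ xs ys r)

==L-refl : ∀ xs → T (xs ==L xs)
==L-refl []       = tt
==L-refl (x ∷ xs) = T-∧⁺ (ℕ.≡⇒≡ᵇ x x refl) (==L-refl xs)

≡⇒==L : ∀ {xs ys} → xs ≡ ys → T (xs ==L ys)
≡⇒==L {xs} refl = ==L-refl xs

==L-sym : ∀ xs ys → ⟦ xs ==L ys ⟧ ≡ ⟦ ys ==L xs ⟧
==L-sym xs ys = ⟦⟧-⇔ (λ p → ≡⇒==L (sym (==L⇒≡ xs ys p))) (λ p → ≡⇒==L (sym (==L⇒≡ ys xs p)))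

*-⟦⟧-cong : ∀ {x y} {b} → (T b → x ≡ y) → x * ⟦ b ⟧ ≡ y * ⟦ b ⟧
*-⟦⟧-cong {b = true}  p = cong (_* + 1) (p tt)
*-⟦⟧-cong {x} {y} {b = false} p = trans (*-zeroʳ x) (sym (*-zeroʳ y))

⟦⟧-*-cong : ∀ {x y} {b} → (T b → x ≡ y) → ⟦ b ⟧ * x ≡ ⟦ b ⟧ * y
⟦⟧-*-cong {x} {y} {b} p = trans (*-comm ⟦ b ⟧ x) (trans (*-⟦⟧-cong p) (*-comm y ⟦ b ⟧))

-- Enumeration of partitions

part-≡ : ∀ {ρ ν : Partition} → proj₁ ρ ≡ proj₁ ν → ρ ≡ ν
part-≡ {l , p} {.l , q} refl = cong (l ,_) (T-irrelevant p q)

-- Follows the recursion of `pbF`, which hands each part down as the upper bound for the next one.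
boundedPart : ℕ → List ℕ → Bool
boundedPart n []       = true
boundedPart n (x ∷ xs) = (1 ≤ᵇ x) ∧ ((x ≤ᵇ n) ∧ boundedPart x xs)

∑-upTo-⟦≡ᵇ⟧ : ∀ n y (h : ℕ → ℤ) → ∑ (upTo n) (λ i → ⟦ i ≡ᵇ y ⟧ * h i) ≡ ⟦ y <ᵇ n ⟧ * h y
∑-upTo-⟦≡ᵇ⟧ zero    y h = sym (*-zeroˡ (h y))
∑-upTo-⟦≡ᵇ⟧ (suc n) y h = trans (cong (λ xs → ⟦ 0 ≡ᵇ y ⟧ * h 0 + ∑ xs _) (sym (List.map-upTo suc n)))
  (trans (cong (_+_ (⟦ 0 ≡ᵇ y ⟧ * h 0)) (∑-map suc (upTo n) _)) (shift y))
  where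
  shift : ∀ y → ⟦ 0 ≡ᵇ y ⟧ * h 0 + ∑ (upTo n) (λ i → ⟦ suc i ≡ᵇ y ⟧ * h (suc i)) ≡ ⟦ y <ᵇ suc n ⟧ * h y
  shift zero    = trans (cong (_+_ (+ 1 * h 0)) (∑-vanish (upTo n) λ i → *-zeroˡ (h (suc i)))) (+-identityʳ _)
  shift (suc y) = trans (cong₂ _+_ (*-zeroˡ (h 0)) (∑-upTo-⟦≡ᵇ⟧ n y (h ∘ suc))) (+-identityˡ _)

∑-applyUpTo-suc-⟦≡ᵇ⟧ : ∀ n x (h : ℕ → ℤ) →
  ∑ (applyUpTo suc n) (λ p → ⟦ p ≡ᵇ x ⟧ * h p) ≡ ⟦ (1 ≤ᵇ x) ∧ (x ≤ᵇ n) ⟧ * h x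
∑-applyUpTo-suc-⟦≡ᵇ⟧ n x h = trans (cong (λ xs → ∑ xs _) (sym (List.map-upTo suc n)))
  (trans (∑-map suc (upTo n) _) (shift x))
  where
  shift : ∀ x → ∑ (upTo n) (λ i → ⟦ suc i ≡ᵇ x ⟧ * h (suc i)) ≡ ⟦ (1 ≤ᵇ x) ∧ (x ≤ᵇ n) ⟧ * h x
  shift zero    = ∑-vanish (upTo n) λ i → *-zeroˡ (h (suc i))
  shift (suc x) = ∑-upTo-⟦≡ᵇ⟧ n x (h ∘ suc)

-- The first part of `l` fixes the only branch of `pbF` that can produce `l`. That part is at least
-- 1, so the remaining sum drops and stays within the fuel. Hence every admissible list is produced
-- exactly once.
pbF-multiplicity : ∀ f n b l → n ≤ f → ∑ (pbF f n b) (λ l′ → ⟦ l′ ==L l ⟧) ≡ ⟦ boundedPart b l ∧ (sum l ≡ᵇ n) ⟧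
pbF-multiplicity zero    zero    b []            _ = refl
pbF-multiplicity zero    zero    b (zero ∷ l)    _ = refl
pbF-multiplicity zero    zero    b (suc x ∷ l)   _ = cong ⟦_⟧ (sym (∧-zeroʳ _))
pbF-multiplicity (suc f) zero    b []            _ = refl
pbF-multiplicity (suc f) zero    b (zero ∷ l)    _ = refl
pbF-multiplicity (suc f) zero    b (suc x ∷ l)   _ = cong ⟦_⟧ (sym (∧-zeroʳ _))
pbF-multiplicity (suc f) (suc n) b l (s≤s n≤f) =
  trans (∑-concatMap (λ p → map (p ∷_) (pbF f (suc n ∸ p) p)) (applyUpTo suc (b ℕ.⊓ suc n)) (λ l′ → ⟦ l′ ==L l ⟧))
  (trans (∑-cong (applyUpTo suc (b ℕ.⊓ suc n)) (λ p → ∑-map (p ∷_) (pbF f (suc n ∸ p) p) (λ l′ → ⟦ l′ ==L l ⟧))) (byHead l))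
  where
  byHead : ∀ l → ∑ (applyUpTo suc (b ℕ.⊓ suc n)) (λ p → ∑ (pbF f (suc n ∸ p) p) (λ l′ → ⟦ (p ∷ l′) ==L l ⟧))
    ≡ ⟦ boundedPart b l ∧ (sum l ≡ᵇ suc n) ⟧
  byHead []      = ∑-vanish (applyUpTo suc (b ℕ.⊓ suc n)) λ p → ∑-zero (pbF f (suc n ∸ p) p)
  byHead (x ∷ l) = trans
    (∑-cong (applyUpTo suc (b ℕ.⊓ suc n)) λ p →
      trans (∑-cong (pbF f (suc n ∸ p) p) λ l′ → ⟦⟧-∧ (p ≡ᵇ x) (l′ ==L l))
      (∑-*ˡ ⟦ p ≡ᵇ x ⟧ (pbF f (suc n ∸ p) p) (λ l′ → ⟦ l′ ==L l ⟧)))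
    (trans (∑-applyUpTo-suc-⟦≡ᵇ⟧ (b ℕ.⊓ suc n) x _)
    (trans (⟦⟧-*-cong {b = (1 ≤ᵇ x) ∧ (x ≤ᵇ b ℕ.⊓ suc n)} λ q →
        pbF-multiplicity f (suc n ∸ x) x l (tail≤ x (proj₁ (T-∧⁻ q))))
    (trans (sym (⟦⟧-∧ ((1 ≤ᵇ x) ∧ (x ≤ᵇ b ℕ.⊓ suc n)) _)) (⟦⟧-⇔ to from))))
    where
    tail≤ : ∀ x → T (1 ≤ᵇ x) → suc n ∸ x ≤ f
    tail≤ (suc x) _ = ℕ.≤-trans (ℕ.m∸n≤m n x) n≤f
    to : T (((1 ≤ᵇ x) ∧ (x ≤ᵇ b ℕ.⊓ suc n)) ∧ (boundedPart x l ∧ (sum l ≡ᵇ suc n ∸ x))) →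
         T (((1 ≤ᵇ x) ∧ ((x ≤ᵇ b) ∧ boundedPart x l)) ∧ (x ℕ.+ sum l ≡ᵇ suc n))
    to q with T-∧⁻ q
    ... | q₁ , q₂ with T-∧⁻ {1 ≤ᵇ x} q₁ | T-∧⁻ {boundedPart x l} q₂
    ... | 1≤x , x≤ | bl , s with ℕ.≤ᵇ⇒≤ x _ x≤
    ... | x≤′ = T-∧⁺ (T-∧⁺ 1≤x (T-∧⁺ (ℕ.≤⇒≤ᵇ (ℕ.≤-trans x≤′ (ℕ.m⊓n≤m b _))) bl))
      (ℕ.≡⇒≡ᵇ _ _ (trans (cong (x ℕ.+_) (ℕ.≡ᵇ⇒≡ _ _ s)) (ℕ.m+[n∸m]≡n (ℕ.≤-trans x≤′ (ℕ.m⊓n≤n b _)))))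
    from : T (((1 ≤ᵇ x) ∧ ((x ≤ᵇ b) ∧ boundedPart x l)) ∧ (x ℕ.+ sum l ≡ᵇ suc n)) →
           T (((1 ≤ᵇ x) ∧ (x ≤ᵇ b ℕ.⊓ suc n)) ∧ (boundedPart x l ∧ (sum l ≡ᵇ suc n ∸ x)))
    from q with T-∧⁻ q
    ... | q₁ , s with T-∧⁻ {1 ≤ᵇ x} q₁
    ... | 1≤x , q₂ with T-∧⁻ {x ≤ᵇ b} q₂
    ... | x≤b , bl with ℕ.≡ᵇ⇒≡ (x ℕ.+ sum l) (suc n) s
    ... | e = T-∧⁺ (T-∧⁺ 1≤x (ℕ.≤⇒≤ᵇ (ℕ.⊓-glb (ℕ.≤ᵇ⇒≤ x b x≤b) (subst (x ≤_) e (ℕ.m≤m+n x (sum l))))))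
      (T-∧⁺ bl (ℕ.≡⇒≡ᵇ _ _ (trans (sym (ℕ.m+n∸m≡n x (sum l))) (cong (_∸ x) e))))

isPart-tail : ∀ x l → T (isPart (x ∷ l)) → T (isPart l)
isPart-tail x l p with T-∧⁻ {allPos (x ∷ l)} p
isPart-tail x []      p | _ , _ = tt
isPart-tail x (y ∷ l) p | q , r = T-∧⁺ (proj₂ (T-∧⁻ {1 ≤ᵇ x} q)) (proj₂ (T-∧⁻ {y ≤ᵇ x} r))

isPart-head : ∀ x l → T (isPart (x ∷ l)) → T (1 ≤ᵇ x)
isPart-head x l p = proj₁ (T-∧⁻ {1 ≤ᵇ x} (proj₁ (T-∧⁻ {allPos (x ∷ l)} p)))

-- No part exceeds the total, so the initial bound `n` in `partitionsOf n` excludes no partition of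
-- `n`.
isPart⇒boundedPart : ∀ n l → T (isPart l) → sum l ≤ n → T (boundedPart n l)
isPart⇒boundedPart n []      p s≤n = tt
isPart⇒boundedPart n (x ∷ l) p s≤n = T-∧⁺ (isPart-head x l p)
  (T-∧⁺ (ℕ.≤⇒≤ᵇ (ℕ.≤-trans (ℕ.m≤m+n x (sum l)) s≤n)) (tail x l p))
  where
  tail : ∀ x l → T (isPart (x ∷ l)) → T (boundedPart x l)
  tail x []      p = tt
  tail x (y ∷ l) p = T-∧⁺ (isPart-head y l (isPart-tail x (y ∷ l) p))
    (T-∧⁺ (proj₁ (T-∧⁻ {y ≤ᵇ x} (proj₂ (T-∧⁻ {allPos (x ∷ y ∷ l)} p)))) (tail y l (isPart-tail x (y ∷ l) p)))

∑-toPart : ∀ ls (F : Partition → ℤ) (ν : Partition) →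
  ∑ (mapMaybe' toPart ls) (λ ρ → F ρ * ⟦ proj₁ ρ ==L proj₁ ν ⟧) ≡ F ν * ∑ ls (λ l → ⟦ l ==L proj₁ ν ⟧)
∑-toPart []       F ν = sym (*-zeroʳ (F ν))
∑-toPart (l ∷ ls) F ν with T? (isPart l)
... | yes p = trans (cong₂ _+_ (*-⟦⟧-cong λ q → cong F (part-≡ (==L⇒≡ l (proj₁ ν) q))) (∑-toPart ls F ν))
  (sym (*-distribˡ-+ (F ν) _ _))
... | no ¬p = trans (∑-toPart ls F ν) (cong (F ν *_) (sym (trans (cong (_+ _)
  (⟦⟧-false λ q → ¬p (subst (T ∘ isPart) (sym (==L⇒≡ l (proj₁ ν) q)) (proj₂ ν)))) (+-identityˡ _))))

-- Each partition of `n` is listed once, so the indicator sifts out a single value of `F`. The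
-- coefficients of `mulBasis` and `hH` are read off in this way.
∑-partitionsOf : ∀ n (F : Partition → ℤ) (ν : Partition) →
  ∑ (partitionsOf n) (λ ρ → F ρ * ⟦ proj₁ ρ ==L proj₁ ν ⟧) ≡ F ν * ⟦ size ν ≡ᵇ n ⟧
∑-partitionsOf n F ν = trans (∑-toPart (pbF n n n) F ν) (cong (F ν *_)
  (trans (pbF-multiplicity n n n (proj₁ ν) ℕ.≤-refl)
  (⟦⟧-⇔ (λ q → proj₂ (T-∧⁻ {boundedPart n (proj₁ ν)} q))
        (λ q → T-∧⁺ (isPart⇒boundedPart n (proj₁ ν) (proj₂ ν) (ℕ.≤-reflexive (ℕ.≡ᵇ⇒≡ _ _ q))) q))))

∑-partitionsUpTo : ∀ n (F : Partition → ℤ) (ν : Partition) → size ν ≤ n →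
  ∑ (partitionsUpTo n) (λ ρ → F ρ * ⟦ proj₁ ρ ==L proj₁ ν ⟧) ≡ F ν
∑-partitionsUpTo n F ν ν≤n = trans (∑-concatMap partitionsOf (upTo (suc n)) (λ ρ → F ρ * ⟦ proj₁ ρ ==L proj₁ ν ⟧))
  (trans (∑-cong (upTo (suc n)) λ d → trans (∑-partitionsOf d F ν) (trans (*-comm (F ν) _)
      (cong (_* F ν) (⟦⟧-⇔ {size ν ≡ᵇ d} {d ≡ᵇ size ν} (λ q → ℕ.≡⇒≡ᵇ d _ (sym (ℕ.≡ᵇ⇒≡ _ _ q))) (λ q → ℕ.≡⇒≡ᵇ (size ν) _ (sym (ℕ.≡ᵇ⇒≡ d _ q)))))))
  (trans (∑-upTo-⟦≡ᵇ⟧ (suc n) (size ν) (λ _ → F ν))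
  (trans (cong (_* F ν) (⟦⟧-true (ℕ.<⇒<ᵇ (s≤s ν≤n)))) (*-identityˡ _))))

partitionsOf-size : ∀ n → All (λ ρ → size ρ ≡ n) (partitionsOf n)
partitionsOf-size n = toParts (pbF n n n) (pbF-sum n n n ℕ.≤-refl)
  where
  toParts : ∀ ls → All (λ l → sum l ≡ n) ls → All (λ ρ → size ρ ≡ n) (mapMaybe' toPart ls)
  toParts []       []       = []
  toParts (l ∷ ls) (p ∷ ps) with T? (isPart l)
  ... | yes q = p ∷ toParts ls ps
  ... | no _  = toParts ls ps
  pbF-sum : ∀ f n b → n ≤ f → All (λ l → sum l ≡ n) (pbF f n b)
  pbF-sum zero    zero    b _ = refl ∷ []
  pbF-sum (suc f) zero    b _ = refl ∷ []
  pbF-sum (suc f) (suc n) b (s≤s n≤f) = All.concat⁺ (All.map⁺ (All.applyUpTo⁺₁ suc (b ℕ.⊓ suc n) λ {i} i<b →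
    All.map⁺ (All.map (λ {l} e → trans (cong (suc i ℕ.+_) e) (ℕ.m+[n∸m]≡n (ℕ.≤-trans i<b (ℕ.m⊓n≤n b _))))
      (pbF-sum f (n ∸ i) (suc i) (ℕ.≤-trans (ℕ.m∸n≤m n i) n≤f)))))

-- Coefficients at arbitrary exponent vectors

antidiag : ℕ → List (ℕ × ℕ)
antidiag zero    = (0 , 0) ∷ []
antidiag (suc n) = (0 , suc n) ∷ map (λ (i , j) → suc i , j) (antidiag n)

-- The pairs with β + γ = α entry by entry. Unlike `boxes` with truncated subtraction, this treats
-- both summands alike, so that exchanging and regrouping them is a plain recursion.
splits : List ℕ → List (List ℕ × List ℕ)
splits []      = ([] , []) ∷ []
splits (a ∷ α) = concatMap (λ (i , j) → map (λ (β , γ) → i ∷ β , j ∷ γ) (splits α)) (antidiag a)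

∑-antidiag-suc : ∀ n (f : ℕ × ℕ → ℤ) →
  ∑ (antidiag (suc n)) f ≡ f (0 , suc n) + ∑ (antidiag n) (λ (i , j) → f (suc i , j))
∑-antidiag-suc n f = cong (_+_ (f (0 , suc n))) (∑-map _ (antidiag n) f)

∑-splits-∷ : ∀ a α (f : List ℕ × List ℕ → ℤ) →
  ∑ (splits (a ∷ α)) f ≡ ∑ (antidiag a) (λ (i , j) → ∑ (splits α) (λ (β , γ) → f (i ∷ β , j ∷ γ)))
∑-splits-∷ a α f = trans (∑-concatMap _ (antidiag a) f) (∑-cong (antidiag a) λ _ → ∑-map _ (splits α) f)

antidiag-sum : ∀ n → All (λ (i , j) → i ℕ.+ j ≡ n) (antidiag n)
antidiag-sum zero    = refl ∷ []
antidiag-sum (suc n) = refl ∷ All.map⁺ (All.map (cong suc) (antidiag-sum n))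

splits-sum : ∀ α → All (λ (β , γ) → sum β ℕ.+ sum γ ≡ sum α) (splits α)
splits-sum []      = refl ∷ []
splits-sum (a ∷ α) = All.concat⁺ (All.map⁺ (All.map (λ {(i , j)} e → All.map⁺ (All.map (λ {(β , γ)} e′ →
  trans (ℕ+-interchange i (sum β) j (sum γ)) (cong₂ ℕ._+_ e e′)) (splits-sum α))) (antidiag-sum a)))
  where
  ℕ+-interchange : ∀ a b c d → (a ℕ.+ b) ℕ.+ (c ℕ.+ d) ≡ (a ℕ.+ c) ℕ.+ (b ℕ.+ d)
  ℕ+-interchange a b c d = trans (ℕ.+-assoc a b _) (trans (cong (a ℕ.+_) (trans (sym (ℕ.+-assoc b c d))
    (trans (cong (ℕ._+ d) (ℕ.+-comm b c)) (ℕ.+-assoc c b d)))) (sym (ℕ.+-assoc a c _)))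

∑-upTo-antidiag : ∀ n (f : ℕ → ℕ → ℤ) → ∑ (upTo (suc n)) (λ i → f i (n ∸ i)) ≡ ∑ (antidiag n) (λ (i , j) → f i j)
∑-upTo-antidiag zero    f = refl
∑-upTo-antidiag (suc n) f = trans (cong (λ xs → f 0 (suc n) + ∑ xs (λ i → f i (suc n ∸ i))) (sym (List.map-upTo suc (suc n))))
  (trans (cong (_+_ (f 0 (suc n))) (trans (∑-map suc (upTo (suc n)) (λ i → f i (suc n ∸ i))) (∑-upTo-antidiag n (f ∘ suc))))
  (sym (∑-antidiag-suc n (λ (i , j) → f i j))))

∑-boxes : ∀ α (f : List ℕ → List ℕ → ℤ) → ∑ (boxes α) (λ β → f β (zipWith _∸_ α β)) ≡ ∑ (splits α) (λ (β , γ) → f β γ)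
∑-boxes []      f = refl
∑-boxes (a ∷ α) f = trans (∑-concatMap (λ i → map (i ∷_) (boxes α)) (upTo (suc a)) (λ β → f β (zipWith _∸_ (a ∷ α) β)))
  (trans (∑-cong (upTo (suc a)) λ i → trans (∑-map (i ∷_) (boxes α) (λ β → f β (zipWith _∸_ (a ∷ α) β)))
    (∑-boxes α (λ β γ → f (i ∷ β) ((a ∸ i) ∷ γ))))
  (trans (∑-upTo-antidiag a (λ i j → ∑ (splits α) (λ (β , γ) → f (i ∷ β) (j ∷ γ))))
  (sym (∑-splits-∷ a α (λ (β , γ) → f β γ)))))

-- α ~ β says that the monomials x^α and x^β have the same coefficient in every symmetric function.
infix 4 _~_
data _~_ : List ℕ → List ℕ → Set where
  ~-refl  : ∀ {α} → α ~ α
  ~-sym   : ∀ {α β} → α ~ β → β ~ α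
  ~-trans : ∀ {α β γ} → α ~ β → β ~ γ → α ~ γ
  ~-zero  : ∀ {α} → 0 ∷ α ~ α
  ~-swap  : ∀ {x y α} → x ∷ y ∷ α ~ y ∷ x ∷ α
  ~-cons  : ∀ {x α β} → α ~ β → x ∷ α ~ x ∷ β

-- Sorted shapes as normal forms for `~`

insertD-≤ : ∀ {x y} ys → y ≤ x → insertD x (y ∷ ys) ≡ x ∷ y ∷ ys
insertD-≤ {x} {y} ys y≤x with y ≤ᵇ x | ℕ.≤⇒≤ᵇ y≤x
... | true | _ = refl

insertD-> : ∀ {x y} ys → x < y → insertD x (y ∷ ys) ≡ y ∷ insertD x ys
insertD-> {x} {y} ys x<y with y ≤ᵇ x in eq
... | true  = ⊥-elim (ℕ.<⇒≱ x<y (ℕ.≤ᵇ⇒≤ y x (subst T (sym eq) tt)))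
... | false = refl

insertD-comm-≤ : ∀ {x y} l → x ≤ y → insertD x (insertD y l) ≡ insertD y (insertD x l)
insertD-comm-≤ {x} {y} l x≤y with ℕ.m≤n⇒m<n∨m≡n x≤y
insertD-comm-≤ l x≤y | inj₂ refl = refl
insertD-comm-≤ {x} {y} [] x≤y | inj₁ x<y = trans (insertD-> [] x<y) (sym (insertD-≤ [] x≤y))
insertD-comm-≤ {x} {y} (z ∷ l) x≤y | inj₁ x<y with ℕ.≤-<-connex z x | ℕ.≤-<-connex z y
... | inj₁ z≤x | _ = trans (cong (insertD x) (insertD-≤ l (ℕ.≤-trans z≤x x≤y)))
  (trans (insertD-> (z ∷ l) x<y) (trans (cong (y ∷_) (insertD-≤ l z≤x))
  (sym (trans (cong (insertD y) (insertD-≤ l z≤x)) (insertD-≤ (z ∷ l) x≤y)))))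
... | inj₂ x<z | inj₁ z≤y = trans (cong (insertD x) (insertD-≤ l z≤y))
  (trans (insertD-> (z ∷ l) x<y) (trans (cong (y ∷_) (insertD-> l x<z))
  (sym (trans (cong (insertD y) (insertD-> l x<z)) (insertD-≤ (insertD x l) z≤y)))))
... | inj₂ x<z | inj₂ y<z = trans (cong (insertD x) (insertD-> l y<z))
  (trans (insertD-> (insertD y l) x<z) (trans (cong (z ∷_) (insertD-comm-≤ l x≤y))
  (sym (trans (cong (insertD y) (insertD-> l x<z)) (insertD-> (insertD x l) y<z)))))

insertD-comm : ∀ x y l → insertD x (insertD y l) ≡ insertD y (insertD x l)
insertD-comm x y l with ℕ.≤-total x y
... | inj₁ x≤y = insertD-comm-≤ l x≤y
... | inj₂ y≤x = sym (insertD-comm-≤ l y≤x)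

insertD-~ : ∀ x l → insertD x l ~ x ∷ l
insertD-~ x []      = ~-refl
insertD-~ x (y ∷ l) with y ≤ᵇ x
... | true  = ~-refl
... | false = ~-trans (~-cons (insertD-~ x l)) ~-swap

shape-~ : ∀ α → shape α ~ α
shape-~ []          = ~-refl
shape-~ (zero ∷ α)  = ~-trans (shape-~ α) (~-sym ~-zero)
shape-~ (suc x ∷ α) = ~-trans (insertD-~ (suc x) (shape α)) (~-cons (shape-~ α))

-- With `shape-~` this makes `shape` a complete invariant: two vectors are related by `~` exactly
-- when their shapes agree.
shape-resp : ∀ {α β} → α ~ β → shape α ≡ shape β
shape-resp ~-refl        = refl
shape-resp (~-sym p)     = sym (shape-resp p)
shape-resp (~-trans p q) = trans (shape-resp p) (shape-resp q)
shape-resp ~-zero        = refl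
shape-resp (~-swap {zero} {zero})              = refl
shape-resp (~-swap {zero} {suc y})             = refl
shape-resp (~-swap {suc x} {zero})             = refl
shape-resp (~-swap {suc x} {suc y} {α})        = insertD-comm (suc x) (suc y) (shape α)
shape-resp (~-cons {zero} p)  = shape-resp p
shape-resp (~-cons {suc x} p) = cong (insertD (suc x)) (shape-resp p)

sum-resp : ∀ {α β} → α ~ β → sum α ≡ sum β
sum-resp ~-refl        = refl
sum-resp (~-sym p)     = sym (sum-resp p)
sum-resp (~-trans p q) = trans (sum-resp p) (sum-resp q)
sum-resp ~-zero        = refl
sum-resp (~-swap {x} {y} {α}) = trans (sym (ℕ.+-assoc x y (sum α))) (trans (cong (ℕ._+ sum α) (ℕ.+-comm x y)) (ℕ.+-assoc y x (sum α)))
sum-resp (~-cons {x} p) = cong (x ℕ.+_) (sum-resp p)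

sum-shape : ∀ α → sum (shape α) ≡ sum α
sum-shape α = sum-resp (shape-~ α)

allPos-insertD : ∀ x l → T (1 ≤ᵇ x) → T (allPos l) → T (allPos (insertD x l))
allPos-insertD x []      p q = T-∧⁺ p tt
allPos-insertD x (y ∷ l) p q with y ≤ᵇ x | T-∧⁻ {1 ≤ᵇ y} q
... | true  | _      = T-∧⁺ p q
... | false | r , r′ = T-∧⁺ r (allPos-insertD x l p r′)

isDecr-∷-insertD : ∀ x y l → x < y → T (isDecr (y ∷ l)) → T (isDecr (y ∷ insertD x l))
isDecr-∷-insertD x y []      x<y p = T-∧⁺ (ℕ.≤⇒≤ᵇ (ℕ.<⇒≤ x<y)) tt
isDecr-∷-insertD x y (z ∷ l) x<y p with T-∧⁻ {z ≤ᵇ y} p | ℕ.≤-<-connex z x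
... | z≤y , q | inj₁ z≤x = subst (λ l′ → T (isDecr (y ∷ l′))) (sym (insertD-≤ l z≤x))
  (T-∧⁺ (ℕ.≤⇒≤ᵇ (ℕ.<⇒≤ x<y)) (T-∧⁺ (ℕ.≤⇒≤ᵇ z≤x) q))
... | z≤y , q | inj₂ x<z = subst (λ l′ → T (isDecr (y ∷ l′))) (sym (insertD-> l x<z))
  (T-∧⁺ z≤y (isDecr-∷-insertD x z l x<z q))

isDecr-insertD : ∀ x l → T (isDecr l) → T (isDecr (insertD x l))
isDecr-insertD x []      p = tt
isDecr-insertD x (y ∷ l) p with ℕ.≤-<-connex y x
... | inj₁ y≤x = subst (T ∘ isDecr) (sym (insertD-≤ l y≤x)) (T-∧⁺ (ℕ.≤⇒≤ᵇ y≤x) p)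
... | inj₂ x<y = subst (T ∘ isDecr) (sym (insertD-> l x<y)) (isDecr-∷-insertD x y l x<y p)

shape-isPart : ∀ α → T (isPart (shape α))
shape-isPart []          = tt
shape-isPart (zero ∷ α)  = shape-isPart α
shape-isPart (suc x ∷ α) with T-∧⁻ {allPos (shape α)} (shape-isPart α)
... | p , q = T-∧⁺ (allPos-insertD (suc x) (shape α) tt p) (isDecr-insertD (suc x) (shape α) q)

shapeP : List ℕ → Partition
shapeP α = shape α , shape-isPart α

shape-part : ∀ l → T (isPart l) → shape l ≡ l
shape-part []          p = refl
shape-part (zero ∷ l)  p = ⊥-elim (isPart-head 0 l p)
shape-part (suc x ∷ l) p = trans (cong (insertD (suc x)) (shape-part l (isPart-tail (suc x) l p))) (headLargest l p)
  where
  headLargest : ∀ l → T (isPart (suc x ∷ l)) → insertD (suc x) l ≡ suc x ∷ l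
  headLargest []      p = refl
  headLargest (y ∷ l) p = insertD-≤ l (ℕ.≤ᵇ⇒≤ y (suc x) (proj₁ (T-∧⁻ {y ≤ᵇ suc x} (proj₂ (T-∧⁻ {allPos (suc x ∷ y ∷ l)} p)))))

-- The property that the coefficient functions of symmetric functions have, uniformly in the number
-- of variables.
Resp : (List ℕ → ℤ) → Set
Resp F = ∀ {α β} → α ~ β → F α ≡ F β

Resp₂ : (List ℕ → List ℕ → ℤ) → Set
Resp₂ Φ = ∀ {β β′ γ γ′} → β ~ β′ → γ ~ γ′ → Φ β γ ≡ Φ β′ γ′

-- A permutation of the variables permutes the splittings, and an entry 0 splits only as 0 + 0.
-- Consequently convolution preserves invariance.
∑-splits-resp : ∀ Φ → Resp₂ Φ → Resp (λ α → ∑ (splits α) (λ (β , γ) → Φ β γ))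
∑-splits-resp Φ r ~-refl        = refl
∑-splits-resp Φ r (~-sym p)     = sym (∑-splits-resp Φ r p)
∑-splits-resp Φ r (~-trans p q) = trans (∑-splits-resp Φ r p) (∑-splits-resp Φ r q)
∑-splits-resp Φ r (~-zero {α})  = trans (∑-splits-∷ 0 α (λ (β , γ) → Φ β γ))
  (trans (+-identityʳ _) (∑-cong (splits α) λ _ → r ~-zero ~-zero))
∑-splits-resp Φ r (~-cons {x} {α} {β} p) = trans (∑-splits-∷ x α (λ (β , γ) → Φ β γ))
  (trans (∑-cong (antidiag x) λ (i , j) → ∑-splits-resp (λ β γ → Φ (i ∷ β) (j ∷ γ)) (λ p q → r (~-cons p) (~-cons q)) p)
  (sym (∑-splits-∷ x β (λ (β , γ) → Φ β γ))))
∑-splits-resp Φ r (~-swap {x} {y} {α}) = trans (twice x y)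
  (trans (∑-swap (antidiag x) (antidiag y) (λ (i , j) (i′ , j′) → ∑ (splits α) (λ (β , γ) → Φ (i ∷ i′ ∷ β) (j ∷ j′ ∷ γ))))
  (trans (∑-cong (antidiag y) λ _ → ∑-cong (antidiag x) λ _ → ∑-cong (splits α) λ _ → r ~-swap ~-swap)
  (sym (twice y x))))
  where
  twice : ∀ x y → ∑ (splits (x ∷ y ∷ α)) (λ (β , γ) → Φ β γ) ≡
    ∑ (antidiag x) (λ (i , j) → ∑ (antidiag y) (λ (i′ , j′) → ∑ (splits α) (λ (β , γ) → Φ (i ∷ i′ ∷ β) (j ∷ j′ ∷ γ))))
  twice x y = trans (∑-splits-∷ x (y ∷ α) (λ (β , γ) → Φ β γ))
    (∑-cong (antidiag x) λ (i , j) → ∑-splits-∷ y α (λ (β , γ) → Φ (i ∷ β) (j ∷ γ)))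

-- The coefficient of x^α in `f` for any exponent vector α; the two halves of a splitting of a
-- partition are in general not partitions.
val : Λ → List ℕ → ℤ
val f α = ∑ f (λ t → proj₁ t * ⟦ proj₁ (proj₂ t) ==L shape α ⟧)

coeff-∑ : ∀ f ν → coeff f ν ≡ ∑ f (λ t → proj₁ t * ⟦ proj₁ (proj₂ t) ==L proj₁ ν ⟧)
coeff-∑ []             ν = refl
coeff-∑ ((c , λp) ∷ f) ν with proj₁ λp ==L proj₁ ν
... | true  = cong₂ _+_ (sym (*-identityʳ c)) (coeff-∑ f ν)
... | false = trans (coeff-∑ f ν) (sym (trans (cong (_+ _) (*-zeroʳ c)) (+-identityˡ _)))

coeff-val : ∀ f ν → coeff f ν ≡ val f (proj₁ ν)
coeff-val f ν = trans (coeff-∑ f ν) (cong (λ l → ∑ f (λ t → proj₁ t * ⟦ proj₁ (proj₂ t) ==L l ⟧)) (sym (shape-part (proj₁ ν) (proj₂ ν))))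

val-coeff : ∀ f α → val f α ≡ coeff f (shapeP α)
val-coeff f α = sym (coeff-∑ f (shapeP α))

val-• : ∀ c f α → val (c • f) α ≡ c * val f α
val-• c f α = trans (∑-map _ f _) (trans (∑-cong f λ t → *-assoc c (proj₁ t) _) (∑-*ˡ c f _))

val-concatMap : ∀ (h : A → Λ) xs α → val (concatMap h xs) α ≡ ∑ xs (λ x → val (h x) α)
val-concatMap h xs α = ∑-concatMap h xs _

infixl 7 _⋆_
_⋆_ : (List ℕ → ℤ) → (List ℕ → ℤ) → List ℕ → ℤ
(F ⋆ G) α = ∑ (splits α) (λ (β , γ) → F β * G γ)

⋆-resp : ∀ {F G} → Resp F → Resp G → Resp (F ⋆ G)
⋆-resp {F} {G} rF rG = ∑-splits-resp (λ β γ → F β * G γ) (λ p q → cong₂ _*_ (rF p) (rG q))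

length-filter-∑ : ∀ (P : A → Bool) xs → + length (filter (λ x → T? (P x)) xs) ≡ ∑ xs (λ x → ⟦ P x ⟧)
length-filter-∑ P []       = refl
length-filter-∑ P (x ∷ xs) with P x
... | true  = cong (_+_ (+ 1)) (length-filter-∑ P xs)
... | false = trans (length-filter-∑ P xs) (sym (+-identityˡ _))

isShape : Partition → List ℕ → ℤ
isShape λp α = ⟦ proj₁ λp ==L shape α ⟧

isShape-size : ∀ {λp α} → T (proj₁ λp ==L shape α) → size λp ≡ sum α
isShape-size {λp} {α} p = trans (cong sum (==L⇒≡ (proj₁ λp) (shape α) p)) (sum-shape α)

coeffProd-⋆ : ∀ λp μp νp → + coeffProd λp μp νp ≡ (isShape λp ⋆ isShape μp) (proj₁ νp)
coeffProd-⋆ λp μp νp = trans (length-filter-∑ _ (boxes (proj₁ νp)))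
  (trans (∑-boxes (proj₁ νp) (λ β γ → ⟦ (shape β ==L proj₁ λp) ∧ (shape γ ==L proj₁ μp) ⟧))
  (∑-cong (splits (proj₁ νp)) λ (β , γ) → trans (⟦⟧-∧ (shape β ==L proj₁ λp) _)
    (cong₂ _*_ (==L-sym (shape β) (proj₁ λp)) (==L-sym (shape γ) (proj₁ μp)))))

isShape-⋆-size : ∀ λp μp α → (isShape λp ⋆ isShape μp) α * ⟦ sum α ≡ᵇ size λp ℕ.+ size μp ⟧ ≡ (isShape λp ⋆ isShape μp) α
isShape-⋆-size λp μp α = trans (sym (∑-*ʳ ⟦ sum α ≡ᵇ size λp ℕ.+ size μp ⟧ (splits α) _)) (∑-cong-All (All.map (λ {(β , γ)} → sizes β γ) (splits-sum α)))
  where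
  sizes : ∀ β γ → sum β ℕ.+ sum γ ≡ sum α →
    isShape λp β * isShape μp γ * ⟦ sum α ≡ᵇ size λp ℕ.+ size μp ⟧ ≡ isShape λp β * isShape μp γ
  sizes β γ e = trans (*-assoc (isShape λp β) (isShape μp γ) _)
    (⟦⟧-*-cong {b = proj₁ λp ==L shape β} λ p → trans (⟦⟧-*-cong {b = proj₁ μp ==L shape γ} λ q →
       ⟦⟧-true (ℕ.≡⇒≡ᵇ (sum α) _ (trans (sym e) (sym (cong₂ ℕ._+_ (isShape-size {λp} {β} p) (isShape-size {μp} {γ} q))))))
     (*-identityʳ _))

val-mulBasis : ∀ λp μp α → val (mulBasis λp μp) α ≡ (isShape λp ⋆ isShape μp) α
val-mulBasis λp μp α = trans (∑-map _ (partitionsOf (size λp ℕ.+ size μp)) _)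
  (trans (∑-partitionsOf (size λp ℕ.+ size μp) (λ ρ → + coeffProd λp μp ρ) (shapeP α))
  (trans (cong₂ _*_ (trans (coeffProd-⋆ λp μp (shapeP α)) (⋆-resp {isShape λp} {isShape μp} (isShape-resp λp) (isShape-resp μp) (shape-~ α)))
                    (cong (λ n → ⟦ n ≡ᵇ size λp ℕ.+ size μp ⟧) (sum-shape α)))
  (isShape-⋆-size λp μp α)))
  where
  isShape-resp : ∀ ρ → Resp (isShape ρ)
  isShape-resp ρ p = cong (λ l → ⟦ proj₁ ρ ==L l ⟧) (shape-resp p)

*-interchange : ∀ a b c d → (a * b) * (c * d) ≡ (a * c) * (b * d)
*-interchange = solve-∀

-- Turns identities in Λ into identities of convolutions, where commutativity and associativity are
-- rearrangements of finite sums.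
val-⊗ : ∀ f g α → val (f ⊗ g) α ≡ (val f ⋆ val g) α
val-⊗ f g α = trans (val-concatMap (λ s → concatMap (λ t → (proj₁ s * proj₁ t) • mulBasis (proj₂ s) (proj₂ t)) g) f α)
  (trans (∑-cong f λ s → trans (val-concatMap (λ t → (proj₁ s * proj₁ t) • mulBasis (proj₂ s) (proj₂ t)) g α)
     (∑-cong g λ t → trans (val-• (proj₁ s * proj₁ t) (mulBasis (proj₂ s) (proj₂ t)) α)
       (trans (cong (proj₁ s * proj₁ t *_) (val-mulBasis (proj₂ s) (proj₂ t) α))
       (trans (sym (∑-*ˡ (proj₁ s * proj₁ t) (splits α) _))
         (∑-cong (splits α) λ (β , γ) → *-interchange (proj₁ s) (proj₁ t) (isShape (proj₂ s) β) (isShape (proj₂ t) γ))))))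
  (trans (∑-cong f λ s → ∑-swap g (splits α) (λ t (β , γ) → (proj₁ s * isShape (proj₂ s) β) * (proj₁ t * isShape (proj₂ t) γ)))
  (trans (∑-swap f (splits α) (λ s (β , γ) → ∑ g λ t → (proj₁ s * isShape (proj₂ s) β) * (proj₁ t * isShape (proj₂ t) γ)))
  (∑-cong (splits α) λ (β , γ) → sym (∑-*-∑ f g _ _)))))

-- Convolution

∑-antidiag-sucʳ : ∀ n (f : ℕ → ℕ → ℤ) →
  ∑ (antidiag (suc n)) (λ (i , j) → f i j) ≡ f (suc n) 0 + ∑ (antidiag n) (λ (i , j) → f i (suc j))
∑-antidiag-sucʳ zero    f = swap₂ (f 0 1) (f 1 0)
  where
  swap₂ : ∀ a b → a + (b + + 0) ≡ b + (a + + 0)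
  swap₂ = solve-∀
∑-antidiag-sucʳ (suc n) f = trans (∑-antidiag-suc (suc n) (λ (i , j) → f i j))
  (trans (cong (_+_ (f 0 (suc (suc n)))) (∑-antidiag-sucʳ n (f ∘ suc)))
  (trans (rotate (f 0 (suc (suc n))) (f (suc (suc n)) 0) _)
  (cong (_+_ (f (suc (suc n)) 0)) (sym (∑-antidiag-suc n (λ (i , j) → f i (suc j)))))))
  where
  rotate : ∀ a b c → a + (b + c) ≡ b + (a + c)
  rotate = solve-∀

∑-antidiag-flip : ∀ n (f : ℕ → ℕ → ℤ) → ∑ (antidiag n) (λ (i , j) → f i j) ≡ ∑ (antidiag n) (λ (i , j) → f j i)
∑-antidiag-flip zero    f = refl
∑-antidiag-flip (suc n) f = trans (∑-antidiag-suc n (λ (i , j) → f i j))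
  (trans (cong (_+_ (f 0 (suc n))) (∑-antidiag-flip n (f ∘ suc)))
  (sym (∑-antidiag-sucʳ n (λ i j → f j i))))

-- Both sides run over the triples with sum `n`.
∑-antidiag-assoc : ∀ n (f : ℕ → ℕ → ℕ → ℤ) →
  ∑ (antidiag n) (λ (i , j) → ∑ (antidiag i) (λ (p , q) → f p q j)) ≡
  ∑ (antidiag n) (λ (i , j) → ∑ (antidiag j) (λ (p , q) → f i p q))
∑-antidiag-assoc zero    f = refl
∑-antidiag-assoc (suc n) f = trans (∑-antidiag-suc n (λ (i , j) → ∑ (antidiag i) (λ (p , q) → f p q j)))
  (trans (cong₂ _+_ (+-identityʳ (f 0 0 (suc n)))
    (trans (∑-cong (antidiag n) λ (i , j) → ∑-antidiag-suc i (λ (p , q) → f p q j))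
    (trans (∑-+ (antidiag n) (λ (i , j) → f 0 (suc i) j) (λ (i , j) → ∑ (antidiag i) (λ (p , q) → f (suc p) q j)))
      (cong (_+_ (∑ (antidiag n) (λ (i , j) → f 0 (suc i) j))) (∑-antidiag-assoc n (f ∘ suc))))))
  (trans (sym (+-assoc (f 0 0 (suc n)) _ _))
  (trans (cong (_+ ∑ (antidiag n) (λ (i , j) → ∑ (antidiag j) (λ (p , q) → f (suc i) p q))) (sym (∑-antidiag-suc n (λ (p , q) → f 0 p q))))
  (sym (∑-antidiag-suc n (λ (i , j) → ∑ (antidiag j) (λ (p , q) → f i p q)))))))

∑-antidiag-0 : ∀ n (f : ℕ → ℕ → ℤ) → (∀ i j → f (suc i) j ≡ + 0) → ∑ (antidiag n) (λ (i , j) → f i j) ≡ f 0 n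
∑-antidiag-0 zero    f z = +-identityʳ (f 0 0)
∑-antidiag-0 (suc n) f z = trans (∑-antidiag-suc n (λ (i , j) → f i j))
  (trans (cong (_+_ (f 0 (suc n))) (∑-vanish (antidiag n) λ (i , j) → z i j)) (+-identityʳ _))

∑-splits-flip : ∀ α (Φ : List ℕ → List ℕ → ℤ) → ∑ (splits α) (λ (β , γ) → Φ β γ) ≡ ∑ (splits α) (λ (β , γ) → Φ γ β)
∑-splits-flip []      Φ = refl
∑-splits-flip (a ∷ α) Φ = trans (∑-splits-∷ a α (λ (β , γ) → Φ β γ))
  (trans (∑-cong (antidiag a) λ (i , j) → ∑-splits-flip α (λ β γ → Φ (i ∷ β) (j ∷ γ)))
  (trans (∑-antidiag-flip a (λ i j → ∑ (splits α) (λ (β , γ) → Φ (i ∷ γ) (j ∷ β))))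
  (sym (∑-splits-∷ a α (λ (β , γ) → Φ γ β)))))

∑-splits-assoc : ∀ α (Φ : List ℕ → List ℕ → List ℕ → ℤ) →
  ∑ (splits α) (λ (β , γ) → ∑ (splits β) (λ (δ , ε) → Φ δ ε γ)) ≡
  ∑ (splits α) (λ (β , γ) → ∑ (splits γ) (λ (δ , ε) → Φ β δ ε))
∑-splits-assoc []      Φ = refl
∑-splits-assoc (a ∷ α) Φ = trans (∑-splits-∷ a α (λ (β , γ) → ∑ (splits β) (λ (δ , ε) → Φ δ ε γ)))
  (trans (∑-cong (antidiag a) λ (i , j) → trans
    (∑-cong (splits α) λ (β , γ) → ∑-splits-∷ i β (λ (δ , ε) → Φ δ ε (j ∷ γ)))
    (∑-swap (splits α) (antidiag i) (λ (β , γ) (p , q) → ∑ (splits β) (λ (δ , ε) → Φ (p ∷ δ) (q ∷ ε) (j ∷ γ)))))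
  (trans (∑-antidiag-assoc a (λ p q j → ∑ (splits α) (λ (β , γ) → ∑ (splits β) (λ (δ , ε) → Φ (p ∷ δ) (q ∷ ε) (j ∷ γ)))))
  (trans (∑-cong (antidiag a) λ (i , j) → trans
    (∑-cong (antidiag j) λ (p , q) → ∑-splits-assoc α (λ δ ε γ → Φ (i ∷ δ) (p ∷ ε) (q ∷ γ)))
    (trans (∑-swap (antidiag j) (splits α) (λ (p , q) (β , γ) → ∑ (splits γ) (λ (δ , ε) → Φ (i ∷ β) (p ∷ δ) (q ∷ ε))))
      (∑-cong (splits α) λ (β , γ) → sym (∑-splits-∷ j γ (λ (δ , ε) → Φ (i ∷ β) δ ε)))))
  (sym (∑-splits-∷ a α (λ (β , γ) → ∑ (splits γ) (λ (δ , ε) → Φ β δ ε)))))))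

⋆-cong : ∀ {F F′ G G′} → F ≗ F′ → G ≗ G′ → F ⋆ G ≗ F′ ⋆ G′
⋆-cong p q α = ∑-cong (splits α) λ (β , γ) → cong₂ _*_ (p β) (q γ)

⋆-comm : ∀ F G → F ⋆ G ≗ G ⋆ F
⋆-comm F G α = trans (∑-splits-flip α (λ β γ → F β * G γ)) (∑-cong (splits α) λ (β , γ) → *-comm (F γ) (G β))

⋆-assoc : ∀ F G K → (F ⋆ G) ⋆ K ≗ F ⋆ (G ⋆ K)
⋆-assoc F G K α = trans (∑-cong (splits α) λ (β , γ) → sym (∑-*ʳ (K γ) (splits β) (λ (δ , ε) → F δ * G ε)))
  (trans (∑-splits-assoc α (λ β γ δ → F β * G γ * K δ))
  (∑-cong (splits α) λ (β , γ) → trans (∑-cong (splits γ) λ (δ , ε) → *-assoc (F β) (G δ) (K ε)) (∑-*ˡ (F β) (splits γ) (λ (δ , ε) → G δ * K ε))))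

⋆-interchange : ∀ F G K L → (F ⋆ G) ⋆ (K ⋆ L) ≗ (F ⋆ K) ⋆ (G ⋆ L)
⋆-interchange F G K L α = trans (⋆-assoc F G (K ⋆ L) α)
  (trans (⋆-cong {F = F} (λ _ → refl) (λ β → trans (sym (⋆-assoc G K L β))
     (trans (⋆-cong {G = L} (⋆-comm G K) (λ _ → refl) β) (⋆-assoc K G L β))) α)
  (sym (⋆-assoc F K (G ⋆ L) α)))

-- Products of the e_r and of the h_r as functions on exponent vectors

hF : ℕ → List ℕ → ℤ
hF r α = ⟦ sum α ≡ᵇ r ⟧

eF : ℕ → List ℕ → ℤ
eF r α = ⟦ replicate r 1 ==L shape α ⟧

∏F : (ℕ → List ℕ → ℤ) → List ℕ → List ℕ → ℤ
∏F G []      = hF 0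
∏F G (r ∷ l) = G r ⋆ ∏F G l

-- `hF 0` is the indicator of the zero vectors, so only the splitting with β = 0 contributes.
⋆-identityˡ : ∀ F → hF 0 ⋆ F ≗ F
⋆-identityˡ F []      = trans (+-identityʳ _) (*-identityˡ (F []))
⋆-identityˡ F (a ∷ α) = trans (∑-splits-∷ a α (λ (β , γ) → hF 0 β * F γ))
  (trans (∑-antidiag-0 a (λ i j → ∑ (splits α) (λ (β , γ) → hF 0 (i ∷ β) * F (j ∷ γ)))
    (λ i j → ∑-vanish (splits α) λ (β , γ) → *-zeroˡ (F (j ∷ γ))))
  (⋆-identityˡ (λ γ → F (a ∷ γ)) α))

-- The factors commute and the factor with index 0 is the unit. So e_κ and h_κ make sense for every
-- exponent vector κ, sorted or not.
∏F-resp : ∀ {G} → G 0 ≗ hF 0 → ∀ {κ κ′} → κ ~ κ′ → ∏F G κ ≗ ∏F G κ′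
∏F-resp G0 ~-refl        α = refl
∏F-resp G0 (~-sym p)     α = sym (∏F-resp G0 p α)
∏F-resp G0 (~-trans p q) α = trans (∏F-resp G0 p α) (∏F-resp G0 q α)
∏F-resp {G} G0 (~-zero {κ}) α = trans (⋆-cong {G = ∏F G κ} G0 (λ _ → refl) α) (⋆-identityˡ (∏F G κ) α)
∏F-resp {G} G0 (~-swap {x} {y} {κ}) α = trans (sym (⋆-assoc (G x) (G y) (∏F G κ) α))
  (trans (⋆-cong {G = ∏F G κ} (⋆-comm (G x) (G y)) (λ _ → refl) α) (⋆-assoc (G y) (G x) (∏F G κ) α))
∏F-resp {G} G0 (~-cons {x} p) α = ⋆-cong {F = G x} (λ _ → refl) (∏F-resp G0 p) α

coeff-mL : ∀ l ν → coeff (mL l) ν ≡ ⟦ l ==L proj₁ ν ⟧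
coeff-mL l ν with T? (isPart l)
... | yes p = trans (coeff-∑ (m (l , p)) ν) (trans (+-identityʳ _) (*-identityˡ _))
... | no ¬p = sym (⟦⟧-false λ q → ¬p (subst (T ∘ isPart) (sym (==L⇒≡ l (proj₁ ν) q)) (proj₂ ν)))

val-mL : ∀ l α → val (mL l) α ≡ ⟦ l ==L shape α ⟧
val-mL l α = trans (val-coeff (mL l) α) (coeff-mL l (shapeP α))

val-eE : ∀ r → val (eE r) ≗ eF r
val-eE r = val-mL (replicate r 1)

val-hH : ∀ r → val (hH r) ≗ hF r
val-hH r α = trans (val-concatMap m (partitionsOf r) α)
  (trans (∑-cong (partitionsOf r) λ ρ → +-identityʳ _)
  (trans (∑-partitionsOf r (λ _ → + 1) (shapeP α))
  (trans (*-identityˡ _) (cong (λ n → ⟦ n ≡ᵇ r ⟧) (sum-shape α)))))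

val-prodΛ : ∀ {g : ℕ → Λ} {G} → (∀ r → val (g r) ≗ G r) → ∀ l → val (prodΛ (map g l)) ≗ ∏F G l
-- `oneΛ` and `hH 0` compute to the same list, the single term m of the empty partition.
val-prodΛ g≗G []      α = val-hH 0 α
val-prodΛ {g} {G} g≗G (r ∷ l) α = trans (val-⊗ (g r) (prodΛ (map g l)) α) (⋆-cong (g≗G r) (val-prodΛ g≗G l) α)

-- ∏F hF l α counts the ℕ-matrices with row sums l and column sums α.
private
  -- Both sides count the corner entries i with i + b = r and i + d = a, where `b` is the rest of
  -- the first row and `d` the rest of the first column.
  corner-count : ∀ a r b d →
    ∑ (antidiag a) (λ (i , j) → ⟦ i ℕ.+ b ≡ᵇ r ⟧ * ⟦ d ≡ᵇ j ⟧) ≡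
    ∑ (antidiag r) (λ (i , j) → ⟦ i ℕ.+ d ≡ᵇ a ⟧ * ⟦ b ≡ᵇ j ⟧)
  corner-count zero    zero    b d = cong (_+ + 0) (*-comm ⟦ b ≡ᵇ 0 ⟧ ⟦ d ≡ᵇ 0 ⟧)
  corner-count zero    (suc r) b d = trans (+-identityʳ _) (trans (*-comm ⟦ b ≡ᵇ suc r ⟧ ⟦ d ≡ᵇ 0 ⟧)
    (sym (∑-antidiag-0 (suc r) (λ i j → ⟦ i ℕ.+ d ≡ᵇ 0 ⟧ * ⟦ b ≡ᵇ j ⟧) (λ i j → *-zeroˡ ⟦ b ≡ᵇ j ⟧))))
  corner-count (suc a) zero    b d = trans (∑-antidiag-0 (suc a) (λ i j → ⟦ i ℕ.+ b ≡ᵇ 0 ⟧ * ⟦ d ≡ᵇ j ⟧) (λ i j → *-zeroˡ ⟦ d ≡ᵇ j ⟧))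
    (trans (*-comm ⟦ b ≡ᵇ 0 ⟧ ⟦ d ≡ᵇ suc a ⟧) (sym (+-identityʳ _)))
  corner-count (suc a) (suc r) b d = trans (∑-antidiag-suc a (λ (i , j) → ⟦ i ℕ.+ b ≡ᵇ suc r ⟧ * ⟦ d ≡ᵇ j ⟧))
    (trans (cong₂ _+_ (*-comm ⟦ b ≡ᵇ suc r ⟧ ⟦ d ≡ᵇ suc a ⟧) (corner-count a r b d))
    (sym (∑-antidiag-suc r (λ (i , j) → ⟦ i ℕ.+ d ≡ᵇ suc a ⟧ * ⟦ b ≡ᵇ j ⟧))))

  -- Moves the sum over the corner entry innermost. `K` is arbitrary so that the same rearrangement
  -- also serves with the roles of rows and columns exchanged.
  collect : ∀ a r α l (K : List ℕ → List ℕ → ℤ) →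
    ∑ (antidiag a) (λ (i , j) → ∑ (splits α) (λ (β , γ) → ⟦ i ℕ.+ sum β ≡ᵇ r ⟧ * ∑ (splits l) (λ (δ , ε) → ⟦ sum δ ≡ᵇ j ⟧ * K ε γ))) ≡
    ∑ (splits α) (λ (β , γ) → ∑ (splits l) (λ (δ , ε) → ∑ (antidiag a) (λ (i , j) → ⟦ i ℕ.+ sum β ≡ᵇ r ⟧ * ⟦ sum δ ≡ᵇ j ⟧) * K ε γ))
  collect a r α l K = trans
    (∑-swap (antidiag a) (splits α) (λ (i , j) (β , γ) → ⟦ i ℕ.+ sum β ≡ᵇ r ⟧ * ∑ (splits l) (λ (δ , ε) → ⟦ sum δ ≡ᵇ j ⟧ * K ε γ)))
    (∑-cong (splits α) λ (β , γ) → trans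
      (∑-cong (antidiag a) λ (i , j) → sym (∑-*ˡ ⟦ i ℕ.+ sum β ≡ᵇ r ⟧ (splits l) (λ (δ , ε) → ⟦ sum δ ≡ᵇ j ⟧ * K ε γ)))
      (trans (∑-swap (antidiag a) (splits l) (λ (i , j) (δ , ε) → ⟦ i ℕ.+ sum β ≡ᵇ r ⟧ * (⟦ sum δ ≡ᵇ j ⟧ * K ε γ)))
      (∑-cong (splits l) λ (δ , ε) → trans
        (∑-cong (antidiag a) λ (i , j) → sym (*-assoc ⟦ i ℕ.+ sum β ≡ᵇ r ⟧ ⟦ sum δ ≡ᵇ j ⟧ (K ε γ)))
        (∑-*ʳ (K ε γ) (antidiag a) (λ (i , j) → ⟦ i ℕ.+ sum β ≡ᵇ r ⟧ * ⟦ sum δ ≡ᵇ j ⟧)))))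

-- The definition of `∏F` peels off rows; here δ is the first column and ε holds what remains of the
-- row sums. The induction removes the first row, and the corner where row and column meet is
-- exchanged by `corner-count`.
∏hF-column : ∀ l a α → ∏F hF l (a ∷ α) ≡ ∑ (splits l) (λ (δ , ε) → ⟦ sum δ ≡ᵇ a ⟧ * ∏F hF ε α)
∏hF-column []      zero    α = sym (trans (+-identityʳ _) (*-identityˡ _))
∏hF-column []      (suc a) α = sym (trans (+-identityʳ _) (*-zeroˡ (hF 0 α)))
∏hF-column (r ∷ l) a       α = trans (∑-splits-∷ a α (λ (β , γ) → ⟦ sum β ≡ᵇ r ⟧ * ∏F hF l γ))
  (trans (∑-cong (antidiag a) λ (i , j) → ∑-cong (splits α) λ (β , γ) → cong (⟦ i ℕ.+ sum β ≡ᵇ r ⟧ *_) (∏hF-column l j γ))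
  (trans (collect a r α l (∏F hF))
  (trans (∑-swap (splits α) (splits l) (λ (β , γ) (δ , ε) → ∑ (antidiag a) (λ (i , j) → ⟦ i ℕ.+ sum β ≡ᵇ r ⟧ * ⟦ sum δ ≡ᵇ j ⟧) * ∏F hF ε γ))
  (trans (∑-cong (splits l) λ (δ , ε) → ∑-cong (splits α) λ (β , γ) → cong (_* ∏F hF ε γ) (corner-count a r (sum β) (sum δ)))
  (trans (sym (collect r a l α (λ γ ε → ∏F hF ε γ)))
  (sym (∑-splits-∷ r l (λ (δ , ε) → ⟦ sum δ ≡ᵇ a ⟧ * ∏F hF ε α))))))))

-- Transposition of matrices: expanding the left side by columns is the recursion that defines the
-- right side.
∏hF-sym : ∀ l α → ∏F hF l α ≡ ∏F hF α l
∏hF-sym l []      = byRows l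
  where
  byRows : ∀ l → ∏F hF l [] ≡ hF 0 l
  byRows []          = refl
  byRows (zero ∷ l)  = trans (+-identityʳ _) (trans (*-identityˡ _) (byRows l))
  byRows (suc r ∷ l) = trans (+-identityʳ _) (*-zeroˡ (∏F hF l []))
∏hF-sym l (a ∷ α) = trans (∏hF-column l a α) (∑-cong (splits l) λ (δ , ε) → cong (⟦ sum δ ≡ᵇ a ⟧ *_) (∏hF-sym ε α))

-- The Hall inner product

Degree≤ : ℕ → Λ → Set
Degree≤ n f = All (λ t → size (proj₂ t) ≤ n) f

Degree≤-mono : ∀ {n n′ f} → n ≤ n′ → Degree≤ n f → Degree≤ n′ f
Degree≤-mono n≤n′ = All.map (λ p → ℕ.≤-trans p n≤n′)

Homogeneous : ℕ → Λ → Set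
Homogeneous n f = All (λ t → size (proj₂ t) ≡ n) f

Homogeneous⇒Degree≤ : ∀ {n n′ f} → Homogeneous n f → n ≤ n′ → Degree≤ n′ f
Homogeneous⇒Degree≤ h n≤n′ = All.map (λ e → ℕ.≤-trans (ℕ.≤-reflexive e) n≤n′) h

Homogeneous-⊗ : ∀ {n n′ f g} → Homogeneous n f → Homogeneous n′ g → Homogeneous (n ℕ.+ n′) (f ⊗ g)
Homogeneous-⊗ df dg = All.concat⁺ (All.map⁺ (All.map (λ {s} p → All.concat⁺ (All.map⁺ (All.map (λ {t} q →
  All.map⁺ (All.map⁺ (All.map (λ e → trans e (cong₂ ℕ._+_ p q))
    (partitionsOf-size (size (proj₂ s) ℕ.+ size (proj₂ t)))))) dg))) df))

Homogeneous-prodΛ : ∀ {g : ℕ → Λ} → (∀ r → Homogeneous r (g r)) → ∀ l → Homogeneous (sum l) (prodΛ (map g l))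
Homogeneous-prodΛ hom []      = refl ∷ []
Homogeneous-prodΛ hom (r ∷ l) = Homogeneous-⊗ (hom r) (Homogeneous-prodΛ hom l)

Homogeneous-hH : ∀ r → Homogeneous r (hH r)
Homogeneous-hH r = All.concat⁺ (All.map⁺ (All.map (λ e → e ∷ []) (partitionsOf-size r)))

sum-replicate-1 : ∀ r → sum (replicate r 1) ≡ r
sum-replicate-1 zero    = refl
sum-replicate-1 (suc r) = cong suc (sum-replicate-1 r)

Homogeneous-eE : ∀ r → Homogeneous r (eE r)
Homogeneous-eE r with T? (isPart (replicate r 1))
... | yes _ = sum-replicate-1 r ∷ []
... | no _  = []

coeff-Homogeneous : ∀ {n f} → Homogeneous n f → ∀ ν → coeff f ν ≡ coeff f ν * ⟦ size ν ≡ᵇ n ⟧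
coeff-Homogeneous {n} {f} h ν = trans (coeff-∑ f ν)
  (trans (∑-cong-All (All.map (λ {t} e → sym (trans (*-assoc (proj₁ t) _ _) (cong (proj₁ t *_) (trans
      (⟦⟧-*-cong {b = proj₁ (proj₂ t) ==L proj₁ ν} λ q →
        ⟦⟧-true (ℕ.≡⇒≡ᵇ (size ν) n (trans (sym (cong sum (==L⇒≡ (proj₁ (proj₂ t)) (proj₁ ν) q))) e)))
      (*-identityʳ _))))) h))
  (trans (∑-*ʳ ⟦ size ν ≡ᵇ n ⟧ f (λ t → proj₁ t * ⟦ proj₁ (proj₂ t) ==L proj₁ ν ⟧)) (cong (_* _) (sym (coeff-∑ f ν)))))

Degree≤-exists : ∀ f → ∃[ n ] Degree≤ n f
Degree≤-exists []            = 0 , []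
Degree≤-exists ((c , ρ) ∷ f) with Degree≤-exists f
... | n , d = size ρ ℕ.⊔ n , ℕ.m≤m⊔n _ n ∷ Degree≤-mono (ℕ.m≤n⊔m (size ρ) n) d

partitionsUpTo-size : ∀ n → All (λ ρ → size ρ ≤ n) (partitionsUpTo n)
partitionsUpTo-size n = All.concat⁺ (All.map⁺ (All.applyUpTo⁺₁ (λ i → i) (suc n) λ {i} i<n →
  All.map (λ e → ℕ.≤-trans (ℕ.≤-reflexive e) (ℕ.s≤s⁻¹ i<n)) (partitionsOf-size i)))

linExt : (Partition → ℤ) → Λ → ℤ
linExt b f = ∑ f (λ t → proj₁ t * b (proj₂ t))

-- A partition may occur several times in the list `f`. Collecting its occurrences shows that a
-- linear functional sees only the coefficients, and the degree bound keeps the collected sum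
-- finite.
linExt-expand : ∀ b {n f} → Degree≤ n f → linExt b f ≡ ∑ (partitionsUpTo n) (λ ρ → coeff f ρ * b ρ)
linExt-expand b {n} {f} d = trans
  (∑-cong-All (All.map (λ {t} p → trans (cong (proj₁ t *_) (sym (∑-partitionsUpTo n b (proj₂ t) p)))
    (sym (∑-*ˡ (proj₁ t) (partitionsUpTo n) (λ ρ → b ρ * ⟦ proj₁ ρ ==L proj₁ (proj₂ t) ⟧)))) d))
  (trans (∑-swap f (partitionsUpTo n) (λ t ρ → proj₁ t * (b ρ * ⟦ proj₁ ρ ==L proj₁ (proj₂ t) ⟧)))
  (∑-cong (partitionsUpTo n) λ ρ → trans
    (∑-cong f λ t → trans (cong (λ z → proj₁ t * (b ρ * z)) (==L-sym (proj₁ ρ) (proj₁ (proj₂ t))))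
      (shuffle (proj₁ t) (b ρ) ⟦ proj₁ (proj₂ t) ==L proj₁ ρ ⟧))
    (trans (∑-*ʳ (b ρ) f (λ t → proj₁ t * ⟦ proj₁ (proj₂ t) ==L proj₁ ρ ⟧)) (cong (_* b ρ) (sym (coeff-∑ f ρ))))))
  where
  shuffle : ∀ x y z → x * (y * z) ≡ x * z * y
  shuffle = solve-∀

linExt-resp-≈ : ∀ b {f g} → f ≈ g → linExt b f ≡ linExt b g
linExt-resp-≈ b {f} {g} f≈g with Degree≤-exists f | Degree≤-exists g
... | n , d | n′ , d′ = trans (linExt-expand b (Degree≤-mono (ℕ.m≤m⊔n n n′) d))
  (trans (∑-cong (partitionsUpTo (n ℕ.⊔ n′)) λ ρ → cong (_* b ρ) (f≈g ρ))
  (sym (linExt-expand b (Degree≤-mono (ℕ.m≤n⊔m n n′) d′))))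

foldr-∑ : ∀ (h : A → ℤ) xs → foldr _+_ (+ 0) (map h xs) ≡ ∑ xs h
foldr-∑ h []       = refl
foldr-∑ h (x ∷ xs) = cong (_+_ (h x)) (foldr-∑ h xs)

module HallProduct (pair : Λ → Λ → ℤ) (isHall : IsHallProduct pair) where
  open IsHallProduct isHall

  gram : Partition → Partition → ℤ
  gram λp μp = pair (m λp) (m μp)

  pair-∑ : ∀ f g → pair f g ≡ ∑ f (λ s → ∑ g (λ t → proj₁ s * proj₁ t * gram (proj₂ s) (proj₂ t)))
  pair-∑ f g = trans (bilinear f g) (trans (foldr-∑ _ f) (∑-cong f λ s → foldr-∑ _ g))

  pair-linExtʳ : ∀ f g → pair f g ≡ ∑ f (λ s → proj₁ s * linExt (gram (proj₂ s)) g)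
  pair-linExtʳ f g = trans (pair-∑ f g) (∑-cong f λ s →
    trans (∑-cong g λ t → *-assoc (proj₁ s) (proj₁ t) (gram (proj₂ s) (proj₂ t)))
    (∑-*ˡ (proj₁ s) g (λ t → proj₁ t * gram (proj₂ s) (proj₂ t))))

  pair-mˡ : ∀ μp g → pair (m μp) g ≡ linExt (gram μp) g
  pair-mˡ μp g = trans (pair-linExtʳ (m μp) g) (trans (+-identityʳ _) (*-identityˡ _))

  pair-mʳ : ∀ f μp → pair f (m μp) ≡ linExt (λ ρ → gram ρ μp) f
  pair-mʳ f μp = trans (pair-∑ f (m μp)) (∑-cong f λ s → trans (+-identityʳ _) (cong (_* gram (proj₂ s) μp) (*-identityʳ (proj₁ s))))

  δ-⟦⟧ : ∀ λp μp → δ λp μp ≡ ⟦ proj₁ λp ==L proj₁ μp ⟧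
  δ-⟦⟧ λp μp with proj₁ λp ==L proj₁ μp
  ... | true  = refl
  ... | false = refl

  hCoeff : Partition → Partition → ℤ
  hCoeff ρ σ = coeff (hP ρ) σ

  hCoeff-sym : ∀ ρ σ → hCoeff ρ σ ≡ hCoeff σ ρ
  hCoeff-sym ρ σ = trans (matrix ρ σ) (trans (∏hF-sym (proj₁ ρ) (proj₁ σ)) (sym (matrix σ ρ)))
    where
    matrix : ∀ ρ σ → hCoeff ρ σ ≡ ∏F hF (proj₁ ρ) (proj₁ σ)
    matrix ρ σ = trans (coeff-val (hP ρ) σ) (val-prodΛ val-hH (proj₁ ρ) (proj₁ σ))

  -- The duality axiom in matrix form: `hCoeff` times `gram` is the identity. Cutting the sum at
  -- degree `n` loses nothing because h_ρ is homogeneous of degree |ρ|.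
  hCoeff-gram : ∀ {n} ρ μp → size ρ ≤ n → ∑ (partitionsUpTo n) (λ σ → hCoeff ρ σ * gram σ μp) ≡ ⟦ proj₁ ρ ==L proj₁ μp ⟧
  hCoeff-gram ρ μp ρ≤n = trans (sym (linExt-expand (λ σ → gram σ μp) (Homogeneous⇒Degree≤ (Homogeneous-prodΛ Homogeneous-hH (proj₁ ρ)) ρ≤n)))
    (trans (sym (pair-mʳ (hP ρ) μp)) (trans (dual ρ μp) (δ-⟦⟧ ρ μp)))

  -- gramᵀ = gramᵀ (hCoeff gram) = (hCoeff gram)ᵀ gram = gram, as hCoeff is symmetric.
  gram-sym : ∀ λp μp → gram λp μp ≡ gram μp λp
  gram-sym λp μp = trans (sym byColumns) (trans (∑-swap P P (λ σ ρ → gram ρ λp * (hCoeff ρ σ * gram σ μp))) byRows)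
    where
    -- The cut-off must keep both partitions, since each of the two evaluations of the double sum
    -- singles out one of them.
    n = size λp ℕ.⊔ size μp
    P = partitionsUpTo n
    byRows : ∑ P (λ ρ → ∑ P (λ σ → gram ρ λp * (hCoeff ρ σ * gram σ μp))) ≡ gram μp λp
    byRows = trans (∑-cong-All (All.map (λ {ρ} ρ≤n → trans (∑-*ˡ (gram ρ λp) P (λ σ → hCoeff ρ σ * gram σ μp))
        (cong (gram ρ λp *_) (hCoeff-gram ρ μp ρ≤n))) (partitionsUpTo-size n)))
      (∑-partitionsUpTo n (λ ρ → gram ρ λp) μp (ℕ.m≤n⊔m (size λp) (size μp)))
    shuffle : ∀ x y z → x * (y * z) ≡ z * (y * x)
    shuffle = solve-∀
    byColumns : ∑ P (λ σ → ∑ P (λ ρ → gram ρ λp * (hCoeff ρ σ * gram σ μp))) ≡ gram λp μp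
    byColumns = trans (∑-cong-All (All.map (λ {σ} σ≤n → trans
        (∑-cong P λ ρ → trans (shuffle (gram ρ λp) (hCoeff ρ σ) (gram σ μp)) (cong (λ z → gram σ μp * (z * gram ρ λp)) (hCoeff-sym ρ σ)))
        (trans (∑-*ˡ (gram σ μp) P (λ ρ → hCoeff σ ρ * gram ρ λp))
        (cong (gram σ μp *_) (hCoeff-gram σ λp σ≤n)))) (partitionsUpTo-size n)))
      (∑-partitionsUpTo n (λ σ → gram σ μp) λp (ℕ.m≤m⊔n (size λp) (size μp)))

  -- Duality with the arguments in the order that the adjunction needs, obtained from the symmetry
  -- of `gram`.
  pair-m-hP : ∀ μp νp → pair (m μp) (hP νp) ≡ ⟦ proj₁ μp ==L proj₁ νp ⟧
  pair-m-hP μp νp = trans (pair-mˡ μp (hP νp))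
    (trans (∑-cong (hP νp) λ t → cong (proj₁ t *_) (gram-sym μp (proj₂ t)))
    (trans (sym (pair-mʳ (hP νp) μp))
    (trans (dual νp μp) (trans (δ-⟦⟧ νp μp) (==L-sym (proj₁ νp) (proj₁ μp))))))

  pair-hPʳ : ∀ f νp → pair f (hP νp) ≡ coeff f νp
  pair-hPʳ f νp = trans (pair-linExtʳ f (hP νp))
    (trans (∑-cong f λ s → cong (proj₁ s *_) (trans (sym (pair-mˡ (proj₂ s) (hP νp))) (pair-m-hP (proj₂ s) νp)))
    (sym (coeff-∑ f νp)))

  hCoeff-graded : ∀ ρ σ → hCoeff ρ σ ≡ hCoeff ρ σ * ⟦ size σ ≡ᵇ size ρ ⟧
  hCoeff-graded ρ = coeff-Homogeneous (Homogeneous-prodΛ Homogeneous-hH (proj₁ ρ))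

  -- gram (hCoeff (π gram)) = gram (π (hCoeff gram)) for the projection π to degree size μp, as hCoeff is graded.
  gram-graded : ∀ μp νp → gram μp νp ≡ gram μp νp * ⟦ size νp ≡ᵇ size μp ⟧
  gram-graded μp νp = trans (sym byColumns) (trans (∑-swap P P (λ σ ρ → gram μp ρ * (hCoeff ρ σ * (inDegree σ * gram σ νp)))) byRows)
    where
    n = size μp ℕ.⊔ size νp
    P = partitionsUpTo n
    inDegree : Partition → ℤ
    inDegree σ = ⟦ size σ ≡ᵇ size μp ⟧
    shuffle : ∀ x y z w → x * (y * (z * w)) ≡ (z * w) * (y * x)
    shuffle = solve-∀
    byColumns : ∑ P (λ σ → ∑ P (λ ρ → gram μp ρ * (hCoeff ρ σ * (inDegree σ * gram σ νp)))) ≡ gram μp νp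
    byColumns = trans (∑-cong-All (All.map (λ {σ} σ≤n → trans
        (∑-cong P λ ρ → trans (shuffle (gram μp ρ) (hCoeff ρ σ) (inDegree σ) (gram σ νp))
          (cong₂ (λ y z → inDegree σ * gram σ νp * (y * z)) (hCoeff-sym ρ σ) (gram-sym μp ρ)))
        (trans (∑-*ˡ (inDegree σ * gram σ νp) P (λ ρ → hCoeff σ ρ * gram ρ μp))
        (cong (inDegree σ * gram σ νp *_) (hCoeff-gram σ μp σ≤n)))) (partitionsUpTo-size n)))
      (trans (∑-partitionsUpTo n (λ σ → inDegree σ * gram σ νp) μp (ℕ.m≤m⊔n (size μp) (size νp)))
      (trans (cong (_* gram μp νp) (⟦⟧-true (ℕ.≡⇒≡ᵇ (size μp) (size μp) refl))) (*-identityˡ (gram μp νp))))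
    commute : ∀ ρ σ → hCoeff ρ σ * inDegree σ ≡ inDegree ρ * hCoeff ρ σ
    commute ρ σ = trans (cong (_* inDegree σ) (hCoeff-graded ρ σ))
      (trans (*-assoc (hCoeff ρ σ) _ _)
      (trans (cong (hCoeff ρ σ *_) (⟦⟧-*-cong {b = size σ ≡ᵇ size ρ} λ q → cong (λ d → ⟦ d ≡ᵇ size μp ⟧) (ℕ.≡ᵇ⇒≡ (size σ) (size ρ) q)))
      (trans (sym (*-assoc (hCoeff ρ σ) _ _)) (trans (cong (_* inDegree ρ) (sym (hCoeff-graded ρ σ))) (*-comm (hCoeff ρ σ) (inDegree ρ))))))
    regroup : ∀ x y z w → x * (y * (z * w)) ≡ x * ((y * z) * w)
    regroup = solve-∀
    factor : ∀ x y z w → x * ((y * z) * w) ≡ (x * y) * (z * w)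
    factor = solve-∀
    byRows : ∑ P (λ ρ → ∑ P (λ σ → gram μp ρ * (hCoeff ρ σ * (inDegree σ * gram σ νp)))) ≡ gram μp νp * inDegree νp
    byRows = trans (∑-cong-All (All.map (λ {ρ} ρ≤n → trans
        (∑-cong P λ σ → trans (regroup (gram μp ρ) (hCoeff ρ σ) (inDegree σ) (gram σ νp))
          (trans (cong (λ z → gram μp ρ * (z * gram σ νp)) (commute ρ σ)) (factor (gram μp ρ) (inDegree ρ) (hCoeff ρ σ) (gram σ νp))))
        (trans (∑-*ˡ (gram μp ρ * inDegree ρ) P (λ σ → hCoeff ρ σ * gram σ νp))
        (cong (gram μp ρ * inDegree ρ *_) (hCoeff-gram ρ νp ρ≤n)))) (partitionsUpTo-size n)))
      (∑-partitionsUpTo n (λ ρ → gram μp ρ * inDegree ρ) νp (ℕ.m≤n⊔m (size μp) (size νp)))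

  -- Meant for e_λ h_γ, whose degree exceeds |μ| as soon as |λ| does: it cuts the sum over all λ
  -- down to a finite one.
  linExt-gram-vanish : ∀ {n f} μp → Homogeneous n f → ¬ n ≡ size μp → linExt (gram μp) f ≡ + 0
  linExt-gram-vanish {n} {f} μp h n≢ = trans (∑-cong-All (All.map (λ {t} e → trans
      (cong (proj₁ t *_) (trans (gram-graded μp (proj₂ t)) (trans (cong (gram μp (proj₂ t) *_)
        (⟦⟧-false λ q → n≢ (trans (sym e) (ℕ.≡ᵇ⇒≡ (size (proj₂ t)) (size μp) q)))) (*-zeroʳ (gram μp (proj₂ t))))))
      (*-zeroʳ (proj₁ t))) h))
    (∑-zero f)

  coeff-skew-m : ∀ {skew} → IsEPerp pair skew → ∀ λp μp νp → coeff (skew λp (m μp)) νp ≡ linExt (gram μp) (eP λp ⊗ hP νp)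
  coeff-skew-m {skew} adj λp μp νp = trans (sym (pair-hPʳ (skew λp (m μp)) νp))
    (trans (adj λp (m μp) (hP νp)) (pair-mˡ μp (eP λp ⊗ hP νp)))

-- The relation Σ (-1)^i e_i h_j = 0

isSquarefree : List ℕ → Bool
isSquarefree []      = true
isSquarefree (x ∷ l) = (x ≤ᵇ 1) ∧ isSquarefree l

isSquarefree-resp : ∀ {α β} → α ~ β → isSquarefree α ≡ isSquarefree β
isSquarefree-resp ~-refl        = refl
isSquarefree-resp (~-sym p)     = sym (isSquarefree-resp p)
isSquarefree-resp (~-trans p q) = trans (isSquarefree-resp p) (isSquarefree-resp q)
isSquarefree-resp ~-zero        = refl
isSquarefree-resp (~-swap {x} {y} {α}) = ∧-leftComm (x ≤ᵇ 1) (y ≤ᵇ 1) (isSquarefree α)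
  where
  ∧-leftComm : ∀ a b c → a ∧ (b ∧ c) ≡ b ∧ (a ∧ c)
  ∧-leftComm true  b     c = refl
  ∧-leftComm false true  c = refl
  ∧-leftComm false false c = refl
isSquarefree-resp (~-cons {x} p) = cong ((x ≤ᵇ 1) ∧_) (isSquarefree-resp p)

-- Separates the degree from a condition that does not mention `r`, so that the sum over `r` can be
-- carried out on the degrees alone.
eF-⟦⟧ : ∀ r α → eF r α ≡ ⟦ r ≡ᵇ sum α ⟧ * ⟦ isSquarefree α ⟧
eF-⟦⟧ r α = trans (⟦⟧-⇔ to from) (⟦⟧-∧ (r ≡ᵇ sum α) (isSquarefree α))
  where
  squarefree-ones : ∀ r → T (isSquarefree (replicate r 1))
  squarefree-ones zero    = tt
  squarefree-ones (suc r) = squarefree-ones r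
  ones : ∀ l → T (isPart l) → T (isSquarefree l) → replicate (sum l) 1 ≡ l
  ones []                  p q = refl
  ones (zero ∷ l)          p q = ⊥-elim (isPart-head 0 l p)
  ones (suc zero ∷ l)      p q = cong (1 ∷_) (ones l (isPart-tail 1 l p) q)
  to : T (replicate r 1 ==L shape α) → T ((r ≡ᵇ sum α) ∧ isSquarefree α)
  to q with ==L⇒≡ (replicate r 1) (shape α) q
  ... | e = T-∧⁺ (ℕ.≡⇒≡ᵇ r (sum α) (trans (sym (sum-replicate-1 r)) (trans (cong sum e) (sum-shape α))))
    (subst T (trans (cong isSquarefree e) (isSquarefree-resp (shape-~ α))) (squarefree-ones r))
  from : T ((r ≡ᵇ sum α) ∧ isSquarefree α) → T (replicate r 1 ==L shape α)
  from q with T-∧⁻ {r ≡ᵇ sum α} q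
  ... | s , sf = ≡⇒==L (trans (cong (λ n → replicate n 1) (trans (ℕ.≡ᵇ⇒≡ r (sum α) s) (sym (sum-shape α))))
    (ones (shape α) (shape-isPart α) (subst T (sym (isSquarefree-resp (shape-~ α))) sf)))

-- The indicators force i = b and j = g, a pair that lies on the antidiagonal exactly when b + g =
-- n.
∑-antidiag-point : ∀ n b g (f : ℕ → ℤ) →
  ∑ (antidiag n) (λ (i , j) → f i * (⟦ i ≡ᵇ b ⟧ * ⟦ g ≡ᵇ j ⟧)) ≡ f b * ⟦ b ℕ.+ g ≡ᵇ n ⟧
∑-antidiag-point zero    zero    g f = trans (+-identityʳ _) (cong (f 0 *_) (*-identityˡ _))
∑-antidiag-point zero    (suc b) g f = trans (+-identityʳ _) (trans (cong (f 0 *_) (*-zeroˡ ⟦ g ≡ᵇ 0 ⟧)) (trans (*-zeroʳ (f 0)) (sym (*-zeroʳ (f (suc b))))))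
∑-antidiag-point (suc n) zero    g f = trans
  (∑-antidiag-0 (suc n) (λ i j → f i * (⟦ i ≡ᵇ 0 ⟧ * ⟦ g ≡ᵇ j ⟧)) (λ i j → trans (cong (f (suc i) *_) (*-zeroˡ ⟦ g ≡ᵇ j ⟧)) (*-zeroʳ (f (suc i)))))
  (cong (f 0 *_) (*-identityˡ _))
∑-antidiag-point (suc n) (suc b) g f = trans (∑-antidiag-suc n (λ (i , j) → f i * (⟦ i ≡ᵇ suc b ⟧ * ⟦ g ≡ᵇ j ⟧)))
  (trans (cong₂ _+_ (trans (cong (f 0 *_) (*-zeroˡ ⟦ g ≡ᵇ suc n ⟧)) (*-zeroʳ (f 0))) (∑-antidiag-point n b g (f ∘ suc)))
  (+-identityˡ _))

signZ-+ : ∀ i j → signZ (i ℕ.+ j) ≡ signZ i * signZ j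
signZ-+ = ℤ.^-distribˡ-+-* (- (+ 1))

-- The squarefree β below α are the subsets of the support of α, signed by their size. Toggling
-- membership of the first nonzero position cancels them in pairs.
∑-splits-signed-squarefree : ∀ α → ¬ sum α ≡ 0 → ∑ (splits α) (λ (β , γ) → signZ (sum β) * ⟦ isSquarefree β ⟧) ≡ + 0
∑-splits-signed-squarefree []          s≢0 = ⊥-elim (s≢0 refl)
∑-splits-signed-squarefree (zero ∷ α)  s≢0 = trans (∑-splits-∷ 0 α (λ (β , γ) → signZ (sum β) * ⟦ isSquarefree β ⟧))
  (trans (+-identityʳ _) (∑-splits-signed-squarefree α s≢0))
∑-splits-signed-squarefree (suc a ∷ α) s≢0 = trans (∑-splits-∷ (suc a) α (λ (β , γ) → signZ (sum β) * ⟦ isSquarefree β ⟧))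
  (trans (∑-antidiag-suc a (λ (i , j) → S i))
  -- A first entry of 2 or more is not squarefree, so only `S 0` and `S 1`, which is its negative,
  -- remain.
  (trans (cong (_+_ (S 0)) (∑-antidiag-0 a (λ i j → S (suc i)) (λ i j → ∑-vanish (splits α) λ (β , γ) → *-zeroʳ (signZ (suc (suc i) ℕ.+ sum β)))))
  (trans (cong (_+_ (S 0)) (trans (∑-cong (splits α) λ (β , γ) → *-assoc (- (+ 1)) (signZ (sum β)) ⟦ isSquarefree β ⟧) (∑-*ˡ (- (+ 1)) (splits α) (λ (β , γ) → signZ (sum β) * ⟦ isSquarefree β ⟧))))
  (cancel (S 0)))))
  where
  S : ℕ → ℤ
  S i = ∑ (splits α) (λ (β , γ) → signZ (i ℕ.+ sum β) * ⟦ isSquarefree (i ∷ β) ⟧)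
  cancel : ∀ x → x + (- (+ 1)) * x ≡ + 0
  cancel = solve-∀

-- For each splitting of α the degrees of the halves force (i, j), which leaves the signed count of
-- squarefree vectors below α. Either α is not of degree n + 1 and every term is 0, or α is nonzero
-- and the count cancels.
eF-hF-cancel : ∀ n α → ∑ (antidiag (suc n)) (λ (i , j) → signZ i * (eF i ⋆ hF j) α) ≡ + 0
eF-hF-cancel n α = trans
  (∑-cong D λ (i , j) → trans (sym (∑-*ˡ (signZ i) (splits α) (λ (β , γ) → eF i β * hF j γ)))
    (∑-cong (splits α) λ (β , γ) → trans (cong (λ z → signZ i * (z * hF j γ)) (eF-⟦⟧ i β))
      (shuffle (signZ i) ⟦ i ≡ᵇ sum β ⟧ ⟦ isSquarefree β ⟧ (hF j γ))))
  (trans (∑-swap D (splits α) (λ (i , j) (β , γ) → signZ i * (⟦ i ≡ᵇ sum β ⟧ * hF j γ) * ⟦ isSquarefree β ⟧))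
  (trans (∑-cong-All (All.map (λ {(β , γ)} e → trans (∑-*ʳ ⟦ isSquarefree β ⟧ D (λ (i , j) → signZ i * (⟦ i ≡ᵇ sum β ⟧ * hF j γ)))
      (trans (cong (_* ⟦ isSquarefree β ⟧) (trans (∑-antidiag-point (suc n) (sum β) (sum γ) signZ) (cong (λ s → signZ (sum β) * ⟦ s ≡ᵇ suc n ⟧) e)))
        (*-swapʳ (signZ (sum β)) ⟦ sum α ≡ᵇ suc n ⟧ ⟦ isSquarefree β ⟧)))
    (splits-sum α)))
  (trans (∑-*ʳ ⟦ sum α ≡ᵇ suc n ⟧ (splits α) (λ (β , γ) → signZ (sum β) * ⟦ isSquarefree β ⟧))
  (trans (*-⟦⟧-cong {y = + 0} {b = sum α ≡ᵇ suc n} λ q → ∑-splits-signed-squarefree α λ z → ℕ.0≢1+n (trans (sym z) (ℕ.≡ᵇ⇒≡ (sum α) (suc n) q)))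
  (*-zeroˡ ⟦ sum α ≡ᵇ suc n ⟧)))))
  where
  D = antidiag (suc n)
  shuffle : ∀ x y z w → x * ((y * z) * w) ≡ x * (y * w) * z
  shuffle = solve-∀

ehProd : List ℕ → List ℕ → Λ
ehProd κ γ = eP (shapeP κ) ⊗ hP (shapeP γ)

eF0≗hF0 : eF 0 ≗ hF 0
eF0≗hF0 α = trans (sym (val-eE 0 α)) (val-hH 0 α)

val-ehProd : ∀ κ γ → val (ehProd κ γ) ≗ ∏F eF κ ⋆ ∏F hF γ
val-ehProd κ γ α = trans (val-⊗ (eP (shapeP κ)) (hP (shapeP γ)) α)
  (⋆-cong (λ β → trans (val-prodΛ val-eE (shape κ) β) (∏F-resp {eF} eF0≗hF0 (shape-~ κ) β))
          (λ β → trans (val-prodΛ val-hH (shape γ) β) (∏F-resp {hF} (λ _ → refl) (shape-~ γ) β)) α)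

-- All that the selection argument uses of Σ (-1)^i e_i h_j = 0. Stated for an arbitrary weight, it
-- lets the induction absorb exponents that are already fixed into the weight.
Cancels : (List ℕ → List ℕ → ℤ) → Set
Cancels W = ∀ c κ γ → ∑ (antidiag (suc c)) (λ (i , j) → W (i ∷ κ) (j ∷ γ)) ≡ + 0

signedEH : (Partition → ℤ) → List ℕ → List ℕ → ℤ
signedEH b κ γ = signZ (sum κ) * linExt b (ehProd κ γ)

signedEH-resp : ∀ b → Resp₂ (signedEH b)
signedEH-resp b p q = cong₂ _*_ (cong signZ (sum-resp p))
  (cong₂ (λ l l′ → linExt b (prodΛ (map eE l) ⊗ prodΛ (map hH l′))) (shape-resp p) (shape-resp q))

linExt-concatMap-• : ∀ b (c : A → ℤ) (h : A → Λ) xs →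
  linExt b (concatMap (λ x → c x • h x) xs) ≡ ∑ xs (λ x → c x * linExt b (h x))
linExt-concatMap-• b c h xs = trans (∑-concatMap (λ x → c x • h x) xs (λ t → proj₁ t * b (proj₂ t)))
  (∑-cong xs λ x → trans (∑-map (λ t → c x * proj₁ t , proj₂ t) (h x) (λ t → proj₁ t * b (proj₂ t)))
    (trans (∑-cong (h x) λ t → *-assoc (c x) (proj₁ t) (b (proj₂ t))) (∑-*ˡ (c x) (h x) (λ t → proj₁ t * b (proj₂ t)))))

-- The factors regroup as (e_i h_j)(e_κ h_γ), so the signed combination is 0 in Λ coefficient by
-- coefficient, and a linear functional sends it to 0.
signedEH-cancels : ∀ b → Cancels (signedEH b)
signedEH-cancels b c κ γ = trans
  (∑-cong D λ (i , j) → trans (cong (_* linExt b (ehProd (i ∷ κ) (j ∷ γ))) (signZ-+ i (sum κ)))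
    (*-swapʳ (signZ i) (signZ (sum κ)) (linExt b (ehProd (i ∷ κ) (j ∷ γ)))))
  (trans (∑-*ʳ (signZ (sum κ)) D (λ (i , j) → signZ i * linExt b (ehProd (i ∷ κ) (j ∷ γ))))
  (trans (cong (_* signZ (sum κ)) (trans (sym (linExt-concatMap-• b (λ (i , j) → signZ i) (λ (i , j) → ehProd (i ∷ κ) (j ∷ γ)) D))
    (linExt-resp-≈ b {combination} {zeroΛ} combination≈0)))
  (*-zeroˡ (signZ (sum κ)))))
  where
  D = antidiag (suc c)
  R = ∏F eF κ ⋆ ∏F hF γ
  combination = concatMap (λ (i , j) → signZ i • ehProd (i ∷ κ) (j ∷ γ)) D
  combination≈0 : combination ≈ zeroΛ
  combination≈0 ν = trans (coeff-val combination ν)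
    (trans (val-concatMap (λ (i , j) → signZ i • ehProd (i ∷ κ) (j ∷ γ)) D α)
    (trans (∑-cong D λ (i , j) → trans (val-• (signZ i) (ehProd (i ∷ κ) (j ∷ γ)) α)
       (trans (cong (signZ i *_) (trans (val-ehProd (i ∷ κ) (j ∷ γ) α) (⋆-interchange (eF i) (∏F eF κ) (hF j) (∏F hF γ) α)))
       (trans (sym (∑-*ˡ (signZ i) (splits α) (λ (β , δ) → (eF i ⋆ hF j) β * R δ)))
       (∑-cong (splits α) λ (β , δ) → sym (*-assoc (signZ i) ((eF i ⋆ hF j) β) (R δ))))))
    (trans (∑-swap D (splits α) (λ (i , j) (β , δ) → signZ i * (eF i ⋆ hF j) β * R δ))
    (∑-vanish (splits α) λ (β , δ) → trans (∑-*ʳ (R δ) D (λ (i , j) → signZ i * (eF i ⋆ hF j) β))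
      (trans (cong (_* R δ) (eF-hF-cancel c β)) (*-zeroˡ (R δ)))))))
    where α = proj₁ ν

-- The deleted entries are the exponents of the monomial x_I^a, for I running over the k-subsets of the variables.
pick : ℕ → ℕ → (List ℕ → ℤ) → List ℕ → ℤ
pick a zero    G β       = G β
pick a (suc k) G []      = + 0
pick a (suc k) G (b ∷ β) = ⟦ a ≡ᵇ b ⟧ * pick a k G β + pick a (suc k) (λ κ → G (b ∷ κ)) β

pick-vanish : ∀ a k G β → (∀ κ → G κ ≡ + 0) → pick a k G β ≡ + 0
pick-vanish a zero    G β       z = z β
pick-vanish a (suc k) G []      z = refl
pick-vanish a (suc k) G (b ∷ β) z = cong₂ _+_
  (trans (cong (⟦ a ≡ᵇ b ⟧ *_) (pick-vanish a k G β z)) (*-zeroʳ ⟦ a ≡ᵇ b ⟧))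
  (pick-vanish a (suc k) (λ κ → G (b ∷ κ)) β (λ κ → z (b ∷ κ)))

pick-cong : ∀ a k {G G′} β → G ≗ G′ → pick a k G β ≡ pick a k G′ β
pick-cong a zero    β       p = p β
pick-cong a (suc k) []      p = refl
pick-cong a (suc k) (b ∷ β) p = cong₂ (λ x y → ⟦ a ≡ᵇ b ⟧ * x + y) (pick-cong a k β p) (pick-cong a (suc k) β (λ κ → p (b ∷ κ)))

pick-∑ : ∀ a k (xs : List A) (G : A → List ℕ → ℤ) β → ∑ xs (λ x → pick a k (G x) β) ≡ pick a k (λ κ → ∑ xs (λ x → G x κ)) β
pick-∑ a zero    xs G β       = refl
pick-∑ a (suc k) xs G []      = ∑-zero xs
pick-∑ a (suc k) xs G (b ∷ β) = trans (∑-+ xs (λ x → ⟦ a ≡ᵇ b ⟧ * pick a k (G x) β) (λ x → pick a (suc k) (λ κ → G x (b ∷ κ)) β))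
  (cong₂ _+_ (trans (∑-*ˡ ⟦ a ≡ᵇ b ⟧ xs (λ x → pick a k (G x) β)) (cong (⟦ a ≡ᵇ b ⟧ *_) (pick-∑ a k xs G β)))
    (pick-∑ a (suc k) xs (λ x κ → G x (b ∷ κ)) β))

∑-antidiag-⟦≡ᵇ⟧ : ∀ n a (h : ℕ → ℤ) → ∑ (antidiag n) (λ (i , j) → ⟦ a ≡ᵇ i ⟧ * h j) ≡ ⟦ a ≤ᵇ n ⟧ * h (n ∸ a)
∑-antidiag-⟦≡ᵇ⟧ zero    zero    h = +-identityʳ _
∑-antidiag-⟦≡ᵇ⟧ zero    (suc a) h = +-identityʳ _
∑-antidiag-⟦≡ᵇ⟧ (suc n) zero    h = ∑-antidiag-0 (suc n) (λ i j → ⟦ 0 ≡ᵇ i ⟧ * h j) (λ i j → *-zeroˡ (h j))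
∑-antidiag-⟦≡ᵇ⟧ (suc n) (suc a) h = trans (∑-antidiag-suc n (λ (i , j) → ⟦ suc a ≡ᵇ i ⟧ * h j))
  (trans (cong₂ _+_ (*-zeroˡ (h (suc n))) (∑-antidiag-⟦≡ᵇ⟧ n a h))
  (trans (+-identityˡ _) (cong (λ b → ⟦ b ⟧ * h (n ∸ a)) (≤ᵇ-suc a n))))
  where
  ≤ᵇ-suc : ∀ a n → (a ≤ᵇ n) ≡ (suc a ≤ᵇ suc n)
  ≤ᵇ-suc zero    n = refl
  ≤ᵇ-suc (suc a) n = refl

-- Fixes the length as well: this is the condition for ν - a^k to exist as a vector with exactly `k`
-- entries.
allParts≥ : ℕ → ℕ → List ℕ → Bool
allParts≥ a zero    []      = true
allParts≥ a zero    (c ∷ ν) = false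
allParts≥ a (suc k) []      = false
allParts≥ a (suc k) (c ∷ ν) = (a ≤ᵇ c) ∧ allParts≥ a k ν

-- A coordinate that is not picked contributes a vanishing alternating sum, so only picking every coordinate survives.
∑-splits-pick : ∀ a k W ν → Resp₂ W → Cancels W → T (allPos ν) →
  ∑ (splits ν) (λ (β , γ) → pick a k (λ κ → W κ γ) β) ≡ ⟦ allParts≥ a k ν ⟧ * W [] (map (_∸ a) ν)
∑-splits-pick a zero    W []          r c p = trans (+-identityʳ _) (sym (*-identityˡ _))
-- Nothing is left to pick but a variable remains. Its exponent is positive because ν is a
-- partition, so its splittings cancel.
∑-splits-pick a zero    W (suc x ∷ ν) r c p = trans (∑-splits-∷ (suc x) ν (λ (β , γ) → W β γ))
  (trans (∑-swap (antidiag (suc x)) (splits ν) (λ (i , j) (β , γ) → W (i ∷ β) (j ∷ γ)))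
  (trans (∑-vanish (splits ν) λ (β , γ) → c x β γ) (sym (*-zeroˡ (W [] (map (_∸ a) (suc x ∷ ν)))))))
∑-splits-pick a (suc k) W []          r c p = trans (+-identityʳ _) (sym (*-zeroˡ (W [] [])))
∑-splits-pick a (suc k) W (suc x ∷ ν) r c p = trans (∑-splits-∷ (suc x) ν (λ (β , γ) → pick a (suc k) (λ κ → W κ γ) β))
  (trans (∑-cong D λ (i , j) → ∑-+ (splits ν) (λ (β , γ) → ⟦ a ≡ᵇ i ⟧ * pick a k (λ κ → W κ (j ∷ γ)) β) (λ (β , γ) → pick a (suc k) (λ κ → W (i ∷ κ) (j ∷ γ)) β))
  (trans (∑-+ D (λ (i , j) → ∑ (splits ν) (λ (β , γ) → ⟦ a ≡ᵇ i ⟧ * pick a k (λ κ → W κ (j ∷ γ)) β)) (λ (i , j) → ∑ (splits ν) (λ (β , γ) → pick a (suc k) (λ κ → W (i ∷ κ) (j ∷ γ)) β)))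
  (trans (cong₂ _+_ picked unpicked) (+-identityʳ _))))
  where
  D = antidiag (suc x)
  picked : ∑ D (λ (i , j) → ∑ (splits ν) (λ (β , γ) → ⟦ a ≡ᵇ i ⟧ * pick a k (λ κ → W κ (j ∷ γ)) β)) ≡
    ⟦ (a ≤ᵇ suc x) ∧ allParts≥ a k ν ⟧ * W [] (map (_∸ a) (suc x ∷ ν))
  picked = trans (∑-cong D λ (i , j) → ∑-*ˡ ⟦ a ≡ᵇ i ⟧ (splits ν) (λ (β , γ) → pick a k (λ κ → W κ (j ∷ γ)) β))
    (trans (∑-antidiag-⟦≡ᵇ⟧ (suc x) a (λ j → ∑ (splits ν) (λ (β , γ) → pick a k (λ κ → W κ (j ∷ γ)) β)))
    (trans (cong (⟦ a ≤ᵇ suc x ⟧ *_) (∑-splits-pick a k (λ κ γ → W κ ((suc x ∸ a) ∷ γ)) ν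
      (λ p q → r p (~-cons q))
      -- The fixed exponent stands in front of the entry that has to cancel; invariance under
      -- `~-swap` moves it behind.
      (λ d κ γ → trans (∑-cong (antidiag (suc d)) λ (i , j) → r ~-refl ~-swap) (c d κ ((suc x ∸ a) ∷ γ)))
      p))
    (trans (sym (*-assoc ⟦ a ≤ᵇ suc x ⟧ ⟦ allParts≥ a k ν ⟧ (W [] (map (_∸ a) (suc x ∷ ν)))))
      (cong (_* W [] (map (_∸ a) (suc x ∷ ν))) (sym (⟦⟧-∧ (a ≤ᵇ suc x) (allParts≥ a k ν)))))))
  unpicked : ∑ D (λ (i , j) → ∑ (splits ν) (λ (β , γ) → pick a (suc k) (λ κ → W (i ∷ κ) (j ∷ γ)) β)) ≡ + 0
  unpicked = trans (∑-swap D (splits ν) (λ (i , j) (β , γ) → pick a (suc k) (λ κ → W (i ∷ κ) (j ∷ γ)) β))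
    (∑-vanish (splits ν) λ (β , γ) → trans (pick-∑ a (suc k) D (λ (i , j) κ → W (i ∷ κ) (j ∷ γ)) β)
      (pick-vanish a (suc k) (λ κ → ∑ D (λ (i , j) → W (i ∷ κ) (j ∷ γ))) β (λ κ → c x κ γ)))

-- Coefficients of the two sides

-- Represents all ways of taking out `k` copies of `a`, which agree up to order, by taking the first
-- ones. With fewer copies the result is a default value that only occurs with the binomial
-- coefficient 0.
remove : ℕ → ℕ → List ℕ → List ℕ
remove a zero    β       = β
remove a (suc k) []      = []
remove a (suc k) (b ∷ β) = if a ≡ᵇ b then remove a k β else b ∷ remove a (suc k) β

∷-remove-~ : ∀ a k β → suc k ≤ count a β → a ∷ remove a (suc k) β ~ remove a k β
∷-remove-~ a k []      ()
∷-remove-~ a k (b ∷ β) k<c with a ≡ᵇ b in eq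
∷-remove-~ a zero    (b ∷ β) k<c | true  with ℕ.≡ᵇ⇒≡ a b (subst T (sym eq) tt)
... | refl = ~-refl
∷-remove-~ a (suc k) (b ∷ β) k<c | true  rewrite eq = ∷-remove-~ a k β (ℕ.s≤s⁻¹ k<c)
∷-remove-~ a zero    (b ∷ β) k<c | false = ~-trans ~-swap (~-cons (∷-remove-~ a 0 β k<c))
∷-remove-~ a (suc k) (b ∷ β) k<c | false rewrite eq = ~-trans ~-swap (~-cons (∷-remove-~ a (suc k) β k<c))

replicate-++-remove-~ : ∀ a k β → k ≤ count a β → replicate k a ++ remove a k β ~ β
replicate-++-remove-~ a zero    β k≤c = ~-refl
replicate-++-remove-~ a (suc k) β k≤c = ~-trans (∷-++-~ k (remove a (suc k) β))
  (~-trans (++-~ k (∷-remove-~ a k β k≤c)) (replicate-++-remove-~ a k β (ℕ.≤-trans (ℕ.n≤1+n k) k≤c)))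
  where
  ++-~ : ∀ k {α β} → α ~ β → replicate k a ++ α ~ replicate k a ++ β
  ++-~ zero    p = p
  ++-~ (suc k) p = ~-cons (++-~ k p)
  ∷-++-~ : ∀ k α → a ∷ (replicate k a ++ α) ~ replicate k a ++ (a ∷ α)
  ∷-++-~ zero    α = ~-refl
  ∷-++-~ (suc k) α = ~-cons (∷-++-~ k α)

nC0≡1 : ∀ n → n C 0 ≡ 1
nC0≡1 n = trans (nCk≡nC[n∸k] {0} {n} z≤n) (nCn≡1 n)

-- For invariant `G` every choice of positions gives the same value, so only their number matters.
-- The recursion of `pick` is then Pascal's rule.
pick-closed : ∀ a k G β → Resp G → pick a k G β ≡ + (count a β C k) * G (remove a k β)
pick-closed a zero    G β       r = sym (trans (cong (λ n → + n * G β) (nC0≡1 (count a β))) (*-identityˡ (G β)))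
pick-closed a (suc k) G []      r = sym (trans (cong (λ n → + n * G []) (k>n⇒nCk≡0 {0} {suc k} (s≤s z≤n))) (*-zeroˡ (G [])))
pick-closed a (suc k) G (b ∷ β) r with a ≡ᵇ b in eq
... | false = trans (cong₂ _+_ (*-zeroˡ (pick a k G β)) (pick-closed a (suc k) (λ κ → G (b ∷ κ)) β (λ p → r (~-cons p)))) (+-identityˡ _)
... | true  = trans (cong₂ _+_ (trans (*-identityˡ (pick a k G β)) (pick-closed a k G β r))
    (trans (pick-closed a (suc k) (λ κ → G (b ∷ κ)) β (λ p → r (~-cons p))) same))
  (trans (sym (*-distribʳ-+ (G (remove a k β)) (+ (c C k)) (+ (c C suc k))))
  (cong (λ n → + n * G (remove a k β)) (nCk+nC[k+1]≡[n+1]C[k+1] c k)))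
  where
  c = count a β
  same : + (c C suc k) * G (b ∷ remove a (suc k) β) ≡ + (c C suc k) * G (remove a k β)
  -- Keeping the present copy of `a` and taking a later one instead only changes the order. If too
  -- few copies follow, both sides have coefficient 0.
  same with suc k ℕ.≤? c
  ... | yes k<c = cong (+ (c C suc k) *_) (r (subst (λ x → x ∷ remove a (suc k) β ~ remove a k β) (ℕ.≡ᵇ⇒≡ a b (subst T (sym eq) tt)) (∷-remove-~ a k β k<c)))
  ... | no ¬k<c with c C suc k | k>n⇒nCk≡0 (ℕ.≰⇒> ¬k<c)
  ...   | _ | refl = trans (*-zeroˡ (G (b ∷ remove a (suc k) β))) (sym (*-zeroˡ (G (remove a k β))))

-- Restricted to positive parts because `~-zero` changes the number of zeros.
count-resp : ∀ {a α β} → α ~ β → count (suc a) α ≡ count (suc a) β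
count-resp ~-refl        = refl
count-resp (~-sym p)     = sym (count-resp p)
count-resp (~-trans p q) = trans (count-resp p) (count-resp q)
count-resp ~-zero        = refl
count-resp {a} (~-swap {x} {y}) with suc a ≡ᵇ x | suc a ≡ᵇ y
... | true  | true  = refl
... | true  | false = refl
... | false | true  = refl
... | false | false = refl
count-resp {a} (~-cons {x} p) with suc a ≡ᵇ x
... | true  = cong suc (count-resp p)
... | false = count-resp p

≡ᵇ-refl : ∀ a → (a ≡ᵇ a) ≡ true
≡ᵇ-refl zero    = refl
≡ᵇ-refl (suc a) = ≡ᵇ-refl a

count-replicate-++ : ∀ a k l → count a (replicate k a ++ l) ≡ k ℕ.+ count a l
count-replicate-++ a zero    l = refl
count-replicate-++ a (suc k) l rewrite ≡ᵇ-refl a = cong suc (count-replicate-++ a k l)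

delete : ℕ → List ℕ → List ℕ
delete x []      = []
delete x (y ∷ l) = if x ≡ᵇ y then l else y ∷ delete x l

delete-insertD : ∀ x l → delete x (insertD x l) ≡ l
delete-insertD x []      rewrite ≡ᵇ-refl x = refl
delete-insertD x (y ∷ l) with y ≤ᵇ x in eq
... | true  rewrite ≡ᵇ-refl x = refl
... | false with x ≡ᵇ y in eq′
...   | true  = ⊥-elim (subst T eq (ℕ.≤⇒≤ᵇ (ℕ.≤-reflexive (sym (ℕ.≡ᵇ⇒≡ x y (subst T (sym eq′) tt))))))
...   | false = cong (y ∷_) (delete-insertD x l)

-- An inserted part can be deleted again, so λ is recovered from λ + (a^k): at most one λ
-- contributes at a given exponent vector.
shape-replicate-injective : ∀ a k {l l′} → shape (replicate k (suc a) ++ l) ≡ shape (replicate k (suc a) ++ l′) → shape l ≡ shape l′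
shape-replicate-injective a zero    e = e
shape-replicate-injective a (suc k) e = shape-replicate-injective a k
  (trans (sym (delete-insertD (suc a) _)) (trans (cong (delete (suc a)) e) (delete-insertD (suc a) _)))

insParts-shape : ∀ a k λp → insParts (suc a) k λp ≡ shape (replicate k (suc a) ++ proj₁ λp)
insParts-shape a k (l , p) = ins k
  where
  sortD-part : ∀ l → T (allPos l) → sortD l ≡ shape l
  sortD-part []          q = refl
  sortD-part (suc x ∷ l) q = cong (insertD (suc x)) (sortD-part l q)
  ins : ∀ k → sortD (replicate k (suc a) ++ l) ≡ shape (replicate k (suc a) ++ l)
  ins zero    = sortD-part l (proj₁ (T-∧⁻ {allPos l} p))
  ins (suc k) = cong (insertD (suc a)) (ins k)

-- For the truncated sum: the partition to be sifted out may lie beyond the cut-off, where its value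
-- is 0 anyway.
∑-partitionsUpTo′ : ∀ n (F : Partition → ℤ) ν → (n < size ν → F ν ≡ + 0) →
  ∑ (partitionsUpTo n) (λ ρ → F ρ * ⟦ proj₁ ρ ==L proj₁ ν ⟧) ≡ F ν
∑-partitionsUpTo′ n F ν z with size ν ℕ.≤? n
... | yes ν≤n = ∑-partitionsUpTo n F ν ν≤n
... | no  ν≰n = trans (∑-cong-All (All.map (λ {ρ} ρ≤n → trans
      (cong (F ρ *_) (⟦⟧-false λ q → ν≰n (subst (_≤ n) (cong sum (==L⇒≡ (proj₁ ρ) (proj₁ ν) q)) ρ≤n)))
      (*-zeroʳ (F ρ))) (partitionsUpTo-size n)))
  (trans (∑-zero (partitionsUpTo n)) (sym (z (ℕ.≰⇒> ν≰n))))

-- C(n_a(λ)+k, k) is the number of ways to choose, in an exponent vector β of m_{λ+(a^k)}, the k entries that are not counted in λ.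
∑-insParts-pick : ∀ n a k (F : Partition → ℤ) β → (∀ ρ → n < size ρ → F ρ ≡ + 0) →
  ∑ (partitionsUpTo n) (λ ρ → (+ ((nPart (suc a) ρ ℕ.+ k) C k) * F ρ) * ⟦ insParts (suc a) k ρ ==L shape β ⟧) ≡
  pick (suc a) k (λ κ → F (shapeP κ)) β
∑-insParts-pick n a k F β z = trans byCount (sym (pick-closed (suc a) k (λ κ → F (shapeP κ)) β λ p → cong F (part-≡ (shape-resp p))))
  where
  c = count (suc a) β
  rest = remove (suc a) k β
  term : Partition → ℤ
  term ρ = + ((nPart (suc a) ρ ℕ.+ k) C k) * F ρ
  byCount : ∑ (partitionsUpTo n) (λ ρ → term ρ * ⟦ insParts (suc a) k ρ ==L shape β ⟧) ≡ + (c C k) * F (shapeP rest)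
  byCount with k ℕ.≤? c
  ... | yes k≤c = trans (∑-cong (partitionsUpTo n) λ ρ → cong (term ρ *_) (⟦⟧-⇔ (to ρ) (from ρ)))
    (trans (∑-partitionsUpTo′ n term (shapeP rest) (λ n< → trans (cong (+ ((nPart (suc a) (shapeP rest) ℕ.+ k) C k) *_) (z (shapeP rest) n<)) (*-zeroʳ (+ ((nPart (suc a) (shapeP rest) ℕ.+ k) C k)))))
    (cong (λ s → + (s C k) * F (shapeP rest)) counts))
    where
    restored : shape (replicate k (suc a) ++ rest) ≡ shape β
    restored = shape-resp (replicate-++-remove-~ (suc a) k β k≤c)
    to : ∀ ρ → T (insParts (suc a) k ρ ==L shape β) → T (proj₁ ρ ==L shape rest)
    to ρ q = ≡⇒==L (trans (sym (shape-part (proj₁ ρ) (proj₂ ρ))) (shape-replicate-injective a k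
      (trans (sym (insParts-shape a k ρ)) (trans (==L⇒≡ (insParts (suc a) k ρ) (shape β) q) (sym restored)))))
    from : ∀ ρ → T (proj₁ ρ ==L shape rest) → T (insParts (suc a) k ρ ==L shape β)
    from ρ q = ≡⇒==L (trans (insParts-shape a k ρ) (trans (prepend k (trans (shape-part (proj₁ ρ) (proj₂ ρ)) (==L⇒≡ (proj₁ ρ) (shape rest) q))) restored))
      where
      prepend : ∀ k {l l′} → shape l ≡ shape l′ → shape (replicate k (suc a) ++ l) ≡ shape (replicate k (suc a) ++ l′)
      prepend zero    e = e
      prepend (suc k) e = cong (insertD (suc a)) (prepend k e)
    -- For the one ρ that occurs, n_a(ρ) + k is the multiplicity of a in β, so its binomial
    -- coefficient counts the k-subsets of positions where β equals a.
    counts : count (suc a) (shape rest) ℕ.+ k ≡ c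
    counts = trans (cong (ℕ._+ k) (count-resp (shape-~ rest))) (trans (ℕ.+-comm (count (suc a) rest) k)
      (trans (sym (count-replicate-++ (suc a) k rest)) (count-resp (replicate-++-remove-~ (suc a) k β k≤c))))
  ... | no k≰c = trans (∑-vanish (partitionsUpTo n) λ ρ → trans (cong (term ρ *_) (⟦⟧-false (tooFew ρ))) (*-zeroʳ (term ρ)))
    (sym (trans (cong (λ s → + s * F (shapeP rest)) (k>n⇒nCk≡0 (ℕ.≰⇒> k≰c))) (*-zeroˡ (F (shapeP rest)))))
    where
    tooFew : ∀ ρ → ¬ T (insParts (suc a) k ρ ==L shape β)
    tooFew ρ q = k≰c (subst (k ≤_) (trans (sym (count-replicate-++ (suc a) k (proj₁ ρ)))
      (trans (sym (count-resp (shape-~ (replicate k (suc a) ++ proj₁ ρ))))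
      (trans (cong (count (suc a)) (trans (sym (insParts-shape a k ρ)) (==L⇒≡ (insParts (suc a) k ρ) (shape β) q)))
      (count-resp (shape-~ β))))) (ℕ.m≤m+n k (count (suc a) (proj₁ ρ))))

-- The coefficients of m_{λ + a^k}

pad : ℕ → List ℕ → List ℕ
pad zero    _        = []
pad (suc k) []       = 0 ∷ pad k []
pad (suc k) (x ∷ xs) = x ∷ pad k xs

-- The local function of addCols has no name outside Defs; unification with the second signature names it.
mutual
  addCols-pad : ℕ → ℕ → Partition → ℕ → List ℕ → List ℕ
  addCols-pad = _

  addCols-pad-determined : ∀ a k x xs (p : T (isPart (x ∷ xs))) →
    addCols a (suc k) (x ∷ xs , p) ≡ (x ℕ.+ a) ∷ map (ℕ._+ a) (addCols-pad a (suc k) (x ∷ xs , p) k xs)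
  -- With both arguments abstracted to variables, the equation determines the unnamed function
  -- everywhere.
  addCols-pad-determined a k x xs p with suc k | (Partition ∋ (x ∷ xs , p))
  ... | _ | _ = refl

addCols-≡ : ∀ a k λp → addCols a k λp ≡ map (ℕ._+ a) (pad k (proj₁ λp))
addCols-≡ a k λp = cong (map (ℕ._+ a)) (go≡pad k (proj₁ λp))
  where
  go≡pad : ∀ j xs → addCols-pad a k λp j xs ≡ pad j xs
  go≡pad zero    xs       = refl
  go≡pad (suc j) []       = cong (0 ∷_) (go≡pad j [])
  go≡pad (suc j) (x ∷ xs) = cong (x ∷_) (go≡pad j xs)

pad-shape-~ : ∀ k l → length l ≤ k → pad k l ~ l
pad-shape-~ zero    []      _       = ~-refl
pad-shape-~ (suc k) []      _       = ~-trans ~-zero (pad-shape-~ k [] z≤n)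
pad-shape-~ (suc k) (x ∷ l) (s≤s q) = ~-cons (pad-shape-~ k l q)

isDecr-tail : ∀ x l → T (isDecr (x ∷ l)) → T (isDecr l)
isDecr-tail x []      p = tt
isDecr-tail x (y ∷ l) p = proj₂ (T-∧⁻ {y ≤ᵇ x} p)

-- In a decreasing list the zeros stand at the end, so dropping them and padding to the old length
-- restores the list.
pad-shape : ∀ l → T (isDecr l) → pad (length l) (shape l) ≡ l
pad-shape []          p = refl
pad-shape (zero ∷ l)  p = trans (cong (pad (suc (length l))) (proj₁ (zeros l p))) (cong (0 ∷_) (proj₂ (zeros l p)))
  where
  zeros : ∀ l → T (isDecr (0 ∷ l)) → shape l ≡ [] × pad (length l) [] ≡ l
  zeros []         p = refl , refl
  zeros (zero ∷ l) p = proj₁ (zeros l p) , cong (0 ∷_) (proj₂ (zeros l p))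
pad-shape (suc x ∷ l) p = trans (cong (pad (suc (length l))) (headLargest x l p)) (cong (suc x ∷_) (pad-shape l (isDecr-tail (suc x) l p)))
  where
  headLargest : ∀ x l → T (isDecr (suc x ∷ l)) → insertD (suc x) (shape l) ≡ suc x ∷ shape l
  headLargest x []          p = refl
  headLargest x (zero ∷ l)  p = headLargest x l (skip l p)
    where
    skip : ∀ l → T (isDecr (0 ∷ l)) → T (isDecr (suc x ∷ l))
    skip []         p = tt
    skip (zero ∷ l) p = p
  headLargest x (suc y ∷ l) p with T-∧⁻ {suc y ≤ᵇ suc x} p
  ... | y≤x , q = trans (cong (insertD (suc x)) (headLargest y l q)) (trans (insertD-≤ (shape l) (ℕ.≤ᵇ⇒≤ (suc y) (suc x) y≤x))
    (cong (suc x ∷_) (sym (headLargest y l q))))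

allParts≥-length : ∀ a k ν → T (allParts≥ a k ν) → length ν ≡ k
allParts≥-length a zero    []      p = refl
allParts≥-length a (suc k) (c ∷ ν) p = cong suc (allParts≥-length a k ν (proj₂ (T-∧⁻ {a ≤ᵇ c} p)))

map-∸-+ : ∀ a k ν → T (allParts≥ a k ν) → map (ℕ._+ a) (map (_∸ a) ν) ≡ ν
map-∸-+ a zero    []      p = refl
map-∸-+ a (suc k) (c ∷ ν) p with T-∧⁻ {a ≤ᵇ c} p
... | a≤c , q = cong₂ _∷_ (ℕ.m∸n+n≡m (ℕ.≤ᵇ⇒≤ a c a≤c)) (map-∸-+ a k ν q)

map-+-∸ : ∀ a l → map (_∸ a) (map (ℕ._+ a) l) ≡ l
map-+-∸ a []      = refl
map-+-∸ a (x ∷ l) = cong₂ _∷_ (ℕ.m+n∸n≡m x a) (map-+-∸ a l)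

allParts≥-map-+ : ∀ a k l → T (allParts≥ a k (map (ℕ._+ a) (pad k l)))
allParts≥-map-+ a zero    l       = tt
allParts≥-map-+ a (suc k) []      = T-∧⁺ (ℕ.≤⇒≤ᵇ (ℕ.m≤n+m a 0)) (allParts≥-map-+ a k [])
allParts≥-map-+ a (suc k) (x ∷ l) = T-∧⁺ (ℕ.≤⇒≤ᵇ (ℕ.m≤n+m a x)) (allParts≥-map-+ a k l)

isDecr-map-∸ : ∀ a l → T (isDecr l) → T (isDecr (map (_∸ a) l))
isDecr-map-∸ a []          p = tt
isDecr-map-∸ a (x ∷ [])    p = tt
isDecr-map-∸ a (x ∷ y ∷ l) p = T-∧⁺ (ℕ.≤⇒≤ᵇ (ℕ.∸-monoˡ-≤ a (ℕ.≤ᵇ⇒≤ y x (proj₁ (T-∧⁻ {y ≤ᵇ x} p)))))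
  (isDecr-map-∸ a (y ∷ l) (proj₂ (T-∧⁻ {y ≤ᵇ x} p)))

shape-length : ∀ l → length (shape l) ≤ length l
shape-length []          = z≤n
shape-length (zero ∷ l)  = ℕ.≤-trans (shape-length l) (ℕ.n≤1+n _)
shape-length (suc x ∷ l) = ℕ.≤-trans (ℕ.≤-reflexive (insertD-length (suc x) (shape l))) (s≤s (shape-length l))
  where
  insertD-length : ∀ x l → length (insertD x l) ≡ suc (length l)
  insertD-length x []      = refl
  insertD-length x (y ∷ l) with y ≤ᵇ x
  ... | true  = refl
  ... | false = cong suc (insertD-length x l)

-- ν - a^k is μ followed by zeros when μ has fewer than `k` parts; `shape` drops these zeros and
-- `pad` restores them, which gives the two directions.
coeff-target : ∀ a k μp νp → coeff (target a k μp) νp ≡ ⟦ allParts≥ a k (proj₁ νp) ⟧ * ⟦ proj₁ μp ==L shape (map (_∸ a) (proj₁ νp)) ⟧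
coeff-target a k μp νp = trans asProduct (trans (sym (⟦⟧-∧ (length μ ≤ᵇ k) _)) (trans (⟦⟧-⇔ to from) (⟦⟧-∧ (allParts≥ a k ν) _)))
  where
  μ = proj₁ μp
  ν = proj₁ νp
  asProduct : coeff (target a k μp) νp ≡ ⟦ length μ ≤ᵇ k ⟧ * ⟦ addCols a k μp ==L ν ⟧
  asProduct with length μ ≤ᵇ k
  ... | true  = trans (coeff-mL (addCols a k μp) νp) (sym (*-identityˡ _))
  ... | false = sym (*-zeroˡ ⟦ addCols a k μp ==L ν ⟧)
  to : T ((length μ ≤ᵇ k) ∧ (addCols a k μp ==L ν)) → T (allParts≥ a k ν ∧ (μ ==L shape (map (_∸ a) ν)))
  to q with T-∧⁻ {length μ ≤ᵇ k} q
  ... | l≤k , e with trans (sym (addCols-≡ a k μp)) (==L⇒≡ (addCols a k μp) ν e)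
  ... | e′ = T-∧⁺ (subst (T ∘ allParts≥ a k) e′ (allParts≥-map-+ a k μ))
    (≡⇒==L (trans (sym (shape-part μ (proj₂ μp))) (trans (sym (shape-resp (pad-shape-~ k μ (ℕ.≤ᵇ⇒≤ (length μ) k l≤k))))
      (cong shape (trans (sym (map-+-∸ a (pad k μ))) (cong (map (_∸ a)) e′))))))
  from : T (allParts≥ a k ν ∧ (μ ==L shape (map (_∸ a) ν))) → T ((length μ ≤ᵇ k) ∧ (addCols a k μp ==L ν))
  from q with T-∧⁻ {allParts≥ a k ν} q
  ... | full , e with ==L⇒≡ μ (shape (map (_∸ a) ν)) e | trans (List.length-map (_∸ a) ν) (allParts≥-length a k ν full)
  ... | μ≡ | len = T-∧⁺ (ℕ.≤⇒≤ᵇ (subst₂ _≤_ (cong length (sym μ≡)) len (shape-length (map (_∸ a) ν))))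
    (≡⇒==L (trans (addCols-≡ a k μp) (trans (cong (map (ℕ._+ a)) (trans (cong₂ pad (sym len) μ≡)
      (pad-shape (map (_∸ a) ν) (isDecr-map-∸ a ν (proj₂ (T-∧⁻ {allPos ν} (proj₂ νp))))))) (map-∸-+ a k ν full))))

-- The coefficients of CM_{a^k} m_μ

mainTheorem14 : (a k : ℕ) → 1 ≤ a →
    (pair : Λ → Λ → ℤ) → IsHallProduct pair →
    (skew : Partition → Λ → Λ) → IsEPerp pair skew →
    (μ : Partition) →
    ∃[ N₀ ] ((N : ℕ) → N₀ ≤ N → CMpartial a k skew N (m μ) ≈ target a k μ)
-- Once |λ| exceeds |μ| the terms vanish for reasons of degree, so the partial sums are stable from
-- |μ| on.
mainTheorem14 (suc a) k _ pair isHall skew isEPerp μ = size μ , λ N μ≤N ν → trans (coeffCM N μ≤N ν) (sym (coeff-target (suc a) k μ ν))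
  where
  open HallProduct pair isHall
  b = gram μ
  -- Up to its sign, `Q γ ρ` is the coefficient of x^γ in e_ρ^⊥ m_μ.
  Q : List ℕ → Partition → ℤ
  Q γ ρ = signZ (size ρ) * linExt b (eP ρ ⊗ hP (shapeP γ))
  weight : Partition → ℤ
  weight ρ = signZ (size ρ) * + ((nPart (suc a) ρ ℕ.+ k) C k)
  shuffle : ∀ s c i l → s * c * (i * l) ≡ c * (s * l) * i
  shuffle = solve-∀

  Q-vanish : ∀ {N} → size μ ≤ N → ∀ γ ρ → N < size ρ → Q γ ρ ≡ + 0
  Q-vanish μ≤N γ ρ N<ρ = trans (cong (signZ (size ρ) *_) (linExt-gram-vanish μ
      (Homogeneous-⊗ (Homogeneous-prodΛ Homogeneous-eE (proj₁ ρ)) (Homogeneous-prodΛ Homogeneous-hH (shape γ)))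
      (ℕ.>⇒≢ (ℕ.≤-trans (s≤s μ≤N) (ℕ.≤-trans N<ρ (ℕ.m≤m+n (size ρ) (sum (shape γ))))))))
    (*-zeroʳ (signZ (size ρ)))

  -- When all variables are picked no factor e remains, and duality evaluates the pairing of m_μ
  -- with h_γ.
  signedEH-[] : ∀ γ → signedEH b [] γ ≡ ⟦ proj₁ μ ==L shape γ ⟧
  signedEH-[] γ = trans (*-identityˡ _) (trans (linExt-resp-≈ b {ehProd [] γ} {hP (shapeP γ)} λ ρ →
      trans (coeff-val (ehProd [] γ) ρ) (trans (val-⊗ oneΛ (hP (shapeP γ)) (proj₁ ρ))
      (trans (⋆-cong {G = val (hP (shapeP γ))} (val-hH 0) (λ _ → refl) (proj₁ ρ))
      (trans (⋆-identityˡ (val (hP (shapeP γ))) (proj₁ ρ)) (sym (coeff-val (hP (shapeP γ)) ρ))))))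
    (trans (sym (pair-mˡ μ (hP (shapeP γ)))) (pair-m-hP μ (shapeP γ))))

  coeffCM : ∀ N → size μ ≤ N → ∀ ν → coeff (CMpartial (suc a) k skew N (m μ)) ν ≡
    ⟦ allParts≥ (suc a) k (proj₁ ν) ⟧ * ⟦ proj₁ μ ==L shape (map (_∸ suc a) (proj₁ ν)) ⟧
  coeffCM N μ≤N ν = trans (coeff-val (CMpartial (suc a) k skew N (m μ)) ν)
    (trans (val-concatMap (λ ρ → weight ρ • (mL (insParts (suc a) k ρ) ⊗ skew ρ (m μ))) (partitionsUpTo N) (proj₁ ν))
    (trans (∑-cong (partitionsUpTo N) λ ρ → trans (val-• (weight ρ) (mL (insParts (suc a) k ρ) ⊗ skew ρ (m μ)) (proj₁ ν))
      (trans (cong (weight ρ *_) (val-⊗ (mL (insParts (suc a) k ρ)) (skew ρ (m μ)) (proj₁ ν)))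
      (trans (sym (∑-*ˡ (weight ρ) (splits (proj₁ ν)) (λ (β , γ) → val (mL (insParts (suc a) k ρ)) β * val (skew ρ (m μ)) γ)))
      (∑-cong (splits (proj₁ ν)) λ (β , γ) → trans
        (cong₂ (λ x y → weight ρ * (x * y)) (val-mL (insParts (suc a) k ρ) β) (trans (val-coeff (skew ρ (m μ)) γ) (coeff-skew-m isEPerp ρ μ (shapeP γ))))
        (shuffle (signZ (size ρ)) (+ ((nPart (suc a) ρ ℕ.+ k) C k)) ⟦ insParts (suc a) k ρ ==L shape β ⟧ (linExt b (eP ρ ⊗ hP (shapeP γ))))))))
    (trans (∑-swap (partitionsUpTo N) (splits (proj₁ ν)) (λ ρ (β , γ) → + ((nPart (suc a) ρ ℕ.+ k) C k) * Q γ ρ * ⟦ insParts (suc a) k ρ ==L shape β ⟧))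
    (trans (∑-cong (splits (proj₁ ν)) λ (β , γ) → trans (∑-insParts-pick N a k (Q γ) β (Q-vanish μ≤N γ))
      (pick-cong (suc a) k β λ κ → cong (λ s → signZ s * linExt b (ehProd κ γ)) (sum-shape κ)))
    (trans (∑-splits-pick (suc a) k (signedEH b) (proj₁ ν) (signedEH-resp b) (signedEH-cancels b) (proj₁ (T-∧⁻ {allPos (proj₁ ν)} (proj₂ ν))))
    (cong (⟦ allParts≥ (suc a) k (proj₁ ν) ⟧ *_) (signedEH-[] (map (_∸ suc a) (proj₁ ν)))))))))
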